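{- For any $k\geq 9$ and any admissible $v$ (that is, any $v$ such that a $(K_v,C_k)$-design exists), $$\left\{ n\geq v-\left\lfloor\frac{k-9}{4}\right\rfloor \;\Big|\; n\equiv 0,1\pmod 3\right\}\subseteq \mathcal{L}_2C_k(v)\subseteq\mathcal{L}_1C_k(v).$$
   Context: Graphs are finite and simple; $\Gamma'\leq\Gamma$ means that $\Gamma'$ is (isomorphic to) a subgraph of $\Gamma$. $K_n$ is the complete graph on $n$ vertices, $C_k$ is the cycle of length $k$, and $P_4$ is the path with $4$ vertices and $3$ edges. For graphs $\Gamma\leq K$, a $(K,\Gamma)$-design is a set of subgraphs of $K$, called blocks, each isomorphic to $\Gamma$, whose edge sets partition $E(K)$. A $(K_v,\Gamma)$-design is also called a $\Gamma$-design of order $v$. Given a $(K,\Gamma)$-design $\mathcal B$ and a $(K',\Gamma')$-design $\mathcal B'$ with $\Gamma'\leq\Gamma$, a down-link from $\mathcal B$ to $\mathcal B'$ is a function $f:\mathcal B\to\mathcal B'$ such that, for every $B\in\mathcal B$, $f(B)$ is a subgraph of $B$ (as an actual graph on the given vertices, not merely up to isomorphism). The complete graphs $K=K_v$ and $K'=K_n$ may have different vertex sets. When such an $f$ exists, $\mathcal B$ is said to be down-linked to $\mathcal B'$. Throughout, the target graph is $\Gamma'=P_4$. $\mathcal{L}_1\Gamma(v)$ is the set of all integers $n$ such that there exists some $\Gamma$-design of order $v$ that can be down-linked to some $P_4$-design of order $n$. $\mathcal{L}_2\Gamma(v)$ is the set of all integers $n$ such that every $\Gamma$-design of order $v$ can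 be down-linked to some $P_4$-design of order $n$. Here these are used with $\Gamma=C_k$. -}

module Defs where

open import Data.Fin.Base using (Fin)
open import Data.List.Base using (List; upTo)
open import Data.List.Membership.DecPropositional using () renaming (_∈?_ to mem?)
open import Data.List.Membership.Propositional using (_∈_)
open import Data.List.Relation.Binary.Subset.Propositional using (_⊆_)
open import Data.List.Relation.Unary.Unique.Propositional using (Unique)
open import Data.List.Relation.Unary.Unique.Propositional.Properties using (upTo⁺)
open import Data.Nat.Base using (ℕ; suc)
open import Data.Nat.Properties using (_≟_)
open import Data.Product using (Σ; ∃; ∃!; _×_; _,_; proj₁; proj₂)
open import Data.Sum using (_⊎_; swap)
open import Data.Unit using (⊤; tt)
open import Level using (0ℓ) renaming (suc to lsuc)
open import Relation.Binary.Core using (Rel)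
open import Relation.Binary.Definitions using (Decidable; Symmetric)
open import Relation.Binary.PropositionalEquality using (_≡_; _≢_; refl; ≢-sym)
open import Relation.Nullary using (¬_; yes)
open import Relation.Nullary.Decidable using (¬?; _×-dec_; _⊎-dec_)
open import Relation.Unary using (Pred)

-- All vertices are drawn from the common universe ℕ, so that graphs with
-- different vertex sets can still be compared as actual subgraphs of one
-- another.  This loses no finite graph up to relabelling.
record Graph : Set₁ where
  field
    vertices : List ℕ
    unique   : Unique vertices
    Adj      : Rel ℕ 0ℓ
    adj?     : Decidable Adj
    adj-sym  : Symmetric Adj
    loopless : ∀ {x} → ¬ Adj x x
    adj-∈    : ∀ {x y} → Adj x y → x ∈ vertices

open Graph public

infix 4 _⊆ᴳ_ _≅_ _≲_

_⊆ᴳ_ : Rel Graph 0ℓ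
H ⊆ᴳ G = (vertices H ⊆ vertices G) × (∀ {x y} → Adj H x y → Adj G x y)

-- The maps are total on ℕ, but only their values on the vertices matter.
record _≅_ (G H : Graph) : Set where
  field
    to       : ℕ → ℕ
    from     : ℕ → ℕ
    to-∈     : ∀ {x} → x ∈ vertices G → to x ∈ vertices H
    from-∈   : ∀ {y} → y ∈ vertices H → from y ∈ vertices G
    from∘to  : ∀ {x} → x ∈ vertices G → from (to x) ≡ x
    to∘from  : ∀ {y} → y ∈ vertices H → to (from y) ≡ y
    to-adj   : ∀ {x y} → Adj G x y → Adj H (to x) (to y)
    from-adj : ∀ {x y} → Adj H x y → Adj G (from x) (from y)

_≲_ : Rel Graph (lsuc 0ℓ)
Γ ≲ K = ∃ λ H → H ⊆ᴳ K × H ≅ Γ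

-- The graph on {0, …, n-1} obtained from R by symmetrising and deleting loops.
graphOn : (n : ℕ) (R : Rel ℕ 0ℓ) → Decidable R → Graph
graphOn n R R? = record
  { vertices = upTo n
  ; unique   = upTo⁺ n
  ; Adj      = λ x y → x ∈ upTo n × y ∈ upTo n × x ≢ y × (R x y ⊎ R y x)
  ; adj?     = λ x y → mem? _≟_ x (upTo n) ×-dec mem? _≟_ y (upTo n)
                       ×-dec ¬? (x ≟ y) ×-dec (R? x y ⊎-dec R? y x)
  ; adj-sym  = λ (x∈ , y∈ , x≢y , r) → y∈ , x∈ , ≢-sym x≢y , swap r
  ; loopless = λ (_ , _ , x≢x , _) → x≢x refl
  ; adj-∈    = proj₁
  }

K : ℕ → Graph
K n = graphOn n (λ _ _ → ⊤) (λ _ _ → yes tt)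

-- The path with n vertices (hence n - 1 edges).
P : ℕ → Graph
P n = graphOn n (λ x y → suc x ≡ y) (λ x y → suc x ≟ y)

-- A cycle only for k ≥ 3.
C : ℕ → Graph
C k = graphOn k (λ x y → suc x ≡ y ⊎ (suc x ≡ k × y ≡ 0))
                (λ x y → (suc x ≟ y) ⊎-dec ((suc x ≟ k) ×-dec (y ≟ 0)))

-- The (necessarily finite) set of blocks is enumerated without repetition;
-- graphs are the same when they are subgraphs of each other.
record Design (G Γ : Graph) : Set₁ where
  field
    Γ≲G       : Γ ≲ G
    size      : ℕ
    block     : Fin size → Graph
    distinct  : ∀ {i j} → block i ⊆ᴳ block j → block j ⊆ᴳ block i → i ≡ j
    block⊆    : ∀ i → block i ⊆ᴳ G
    block≅    : ∀ i → block i ≅ Γ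
    partition : ∀ {x y} → Adj G x y → ∃! _≡_ λ i → Adj (block i) x y

-- The complete graph of order v may live on any v-element vertex set.
record DesignOfOrder (v : ℕ) (Γ : Graph) : Set₁ where
  field
    host     : Graph
    complete : host ≅ K v
    design   : Design host Γ
  open Design design public

record DownLinked {v n Γ Γ′} (𝓑 : DesignOfOrder v Γ) (𝓑′ : DesignOfOrder n Γ′) : Set₁ where
  private
    module 𝓑  = DesignOfOrder 𝓑
    module 𝓑′ = DesignOfOrder 𝓑′
  field
    Γ′≲Γ : Γ′ ≲ Γ
    link : Fin 𝓑.size → Fin 𝓑′.size
    sub  : ∀ i → 𝓑′.block (link i) ⊆ᴳ 𝓑.block i

-- A design requires Γ ≤ K, so the edgeless design of order 1 does not count and
-- v is at least the order of Γ whenever it is admissible.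
Admissible : Graph → ℕ → Set₁
Admissible Γ v = DesignOfOrder v Γ

𝓛₁ : Graph → ℕ → Pred ℕ (lsuc 0ℓ)
𝓛₁ Γ v n = Σ (DesignOfOrder v Γ) λ 𝓑 → Σ (DesignOfOrder n (P 4)) λ 𝓑′ → DownLinked 𝓑 𝓑′

𝓛₂ : Graph → ℕ → Pred ℕ (lsuc 0ℓ)
𝓛₂ Γ v n = (𝓑 : DesignOfOrder v Γ) → Σ (DesignOfOrder n (P 4)) λ 𝓑′ → DownLinked 𝓑 𝓑′

{-# OPTIONS --safe #-}

-- Write t = ⌊(k - 9)/4⌋ and let D consist of two vertices a, b of the target K_n together with the
-- at most t vertices of the C_k-design that lie outside K_n.  As 4 |D| < k, each block contains
-- four consecutive vertices missing D, and these span the path linked to that block.  All links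
-- avoid a and b, so what remains of K_n is the join of the edge ab with a graph G on the other
-- vertices, and the number of remaining edges is divisible by 3.  Any such join decomposes.  Strip
-- P_4s from G until its components are triangles and stars; then a triangle xyz together with the
-- edges to a and b splits as a-x-y-b, a-y-z-b, a-z-x-b, and two leaves y, w hanging at x, z (possibly
-- x = z) are removed by x-y-a-w, z-w-b-y.  What is left is at most one edge and isolated vertices,
-- the latter removed in threes as copies of K_{2,3}, down to K_4 or the join of ab with four isolated
-- vertices.  Only the triangle formed by ab and a single isolated vertex must be prevented, by
-- stopping one step earlier.
module Submission where

open import Data.Bool.Base using (T)
open import Data.Fin.Base using (Fin; zero; suc)
open import Data.List.Base using (List; []; _∷_; _++_; map; concatMap; length; upTo; take; drop; lookup; tabulate)
open import Data.List.Membership.DecPropositional using () renaming (_∈?_ to mem?)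
open import Data.List.Membership.Propositional using (_∈_; _∉_; lose; find)
open import Data.List.Membership.Propositional.Properties
open import Data.List.Properties using (length-++; length-map; length-upTo; length-take; length-drop)
open import Data.List.Relation.Binary.Disjoint.Propositional using (Disjoint)
open import Data.List.Relation.Binary.Permutation.Propositional as ↭ using (_↭_; ↭-refl; ↭-sym; ↭-trans; ↭-prep; ↭-swap; ↭-reflexive; ↭⇒↭ₛ)
open import Data.List.Relation.Binary.Permutation.Propositional.Properties as ↭ using (↭-length; ∈-resp-↭; ++⁺; ++⁺ˡ; ++⁺ʳ; ++-assoc; shift; shifts; ++-commutativeMonoid)
import Data.List.Relation.Binary.Permutation.Setoid.Properties as ↭ₛ
open import Data.List.Relation.Unary.All as All using (All; []; _∷_)
import Data.List.Relation.Unary.All.Properties as All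
open import Data.List.Relation.Unary.AllPairs using ([]; _∷_)
import Data.List.Relation.Unary.AllPairs.Properties as AllPairs
open import Data.List.Relation.Unary.Any using (here; there; any?; satisfied; index)
open import Data.List.Relation.Unary.Any.Properties using (lookup-index)
open import Data.List.Relation.Unary.Unique.DecPropositional using () renaming (unique? to unique?)
open import Data.List.Relation.Unary.Unique.Propositional using (Unique)
open import Data.List.Relation.Unary.Unique.Propositional.Properties using (upTo⁺; concat⁺; take⁺) renaming (map⁺ to Unique-map⁺; ++⁺ to Unique-++⁺)
open import Data.Maybe using (Maybe; just; nothing; is-just; to-witness-T)
open import Data.Nat
open import Data.Nat.Divisibility
open import Data.Nat.DivMod using (m/n*n≤m; m/n≤m)
open import Data.Nat.ListAction using (sum)
open import Data.Nat.Properties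
open import Data.Nat.Solver using (module +-*-Solver)
open import Data.Product using (Σ; ∃; ∃₂; _×_; _,_; proj₁; proj₂)
open import Data.Product.Properties using (≡-dec)
open import Data.Sum using (_⊎_; inj₁; inj₂; map₁)
open import Data.Unit using (⊤; tt)
open import Function using (_∘_; id)
open import Level using (Level)
open import Relation.Binary.Definitions using (DecidableEquality)
open import Relation.Binary.PropositionalEquality
open import Relation.Nullary using (¬_; Dec; yes; no; contradiction)
open import Relation.Nullary.Decidable using (True; False; toWitness; toWitnessFalse; _×-dec_; ¬?)
open import Relation.Unary using (_⊆_)
open import Defs

private variable
  ℓ : Level
  A : Set ℓ

-- Duplicate-free lists up to permutation

Unique-resp-↭ : {xs ys : List A} → xs ↭ ys → Unique xs → Unique ys
Unique-resp-↭ p = ↭ₛ.Unique-resp-↭ (setoid _) (↭⇒↭ₛ p)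

Unique-++⁻ : (xs : List A) {ys : List A} → Unique (xs ++ ys) → Unique xs × Unique ys × Disjoint xs ys
Unique-++⁻ []       u        = [] , u , λ ()
Unique-++⁻ (x ∷ xs) (x∉ ∷ u) with uxs , uys , d ← Unique-++⁻ xs u =
  All.++⁻ˡ xs x∉ ∷ uxs , uys , λ where
    (here refl , y∈) → All.lookup (All.++⁻ʳ xs x∉) y∈ refl
    (there x∈ , y∈)  → d (x∈ , y∈)

∈⇒↭∷ : {x : A} {ys : List A} → x ∈ ys → ∃ λ zs → ys ↭ x ∷ zs
∈⇒↭∷ {x = x} x∈ with ys , zs , refl ← ∈-∃++ x∈ = ys ++ zs , shift x ys zs

∈-∷⁻ : {x y : A} {zs : List A} → x ≢ y → y ∈ x ∷ zs → y ∈ zs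
∈-∷⁻ x≢y (here refl) = contradiction refl x≢y
∈-∷⁻ x≢y (there y∈)  = y∈

⊆⇒↭++ : {xs ys : List A} → Unique xs → (∀ {x} → x ∈ xs → x ∈ ys) → ∃ λ zs → ys ↭ xs ++ zs
⊆⇒↭++ {xs = []}     {ys} _ _ = ys , ↭-refl
⊆⇒↭++ {xs = x ∷ xs} (x∉ ∷ u) xs⊆ys
  with zs , p ← ∈⇒↭∷ (xs⊆ys (here refl))
  with ws , q ← ⊆⇒↭++ {ys = zs} u (λ y∈ → ∈-∷⁻ (All.lookup x∉ y∈) (∈-resp-↭ p (xs⊆ys (there y∈))))
  = ws , ↭-trans p (↭-prep x q)

⊆⇒length≤ : {xs ys : List A} → Unique xs → (∀ {x} → x ∈ xs → x ∈ ys) → length xs ≤ length ys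
⊆⇒length≤ {xs = xs} u xs⊆ys with zs , p ← ⊆⇒↭++ u xs⊆ys =
  subst (length xs ≤_) (sym (trans (↭-length p) (length-++ xs))) (m≤m+n _ _)

module _ (_≟ᴬ_ : DecidableEquality A) where

  -- A search rather than a decision: `nothing` carries no refutation, because `gadget` only needs
  -- success on closed lists.
  ↭? : (xs ys : List A) → Maybe (xs ↭ ys)
  ↭? [] []      = just ↭-refl
  ↭? [] (_ ∷ _) = nothing
  ↭? (x ∷ xs) ys with mem? _≟ᴬ_ x ys
  ... | no  _ = nothing
  ... | yes x∈ with zs , p ← ∈⇒↭∷ x∈ with ↭? xs zs
  ...   | just q  = just (↭-trans (↭-prep x q) (↭-sym p))
  ...   | nothing = nothing

-- Vertex lists as numberings

-- Defaults to 0 past the end.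
nth : List ℕ → ℕ → ℕ
nth []       _       = 0
nth (x ∷ xs) zero    = x
nth (x ∷ xs) (suc i) = nth xs i

-- Defaults to the length when the element is absent.
pos : ℕ → List ℕ → ℕ
pos x [] = 0
pos x (y ∷ ys) with x ≟ y
... | yes _ = 0
... | no  _ = suc (pos x ys)

nth-∈ : ∀ xs {i} → i < length xs → nth xs i ∈ xs
nth-∈ (x ∷ xs) {zero}  _       = here refl
nth-∈ (x ∷ xs) {suc i} (s≤s l) = there (nth-∈ xs l)

pos-< : ∀ {x xs} → x ∈ xs → pos x xs < length xs
pos-< {x} {y ∷ ys} x∈ with x ≟ y
... | yes _ = z<s
pos-< (here refl) | no x≢y = contradiction refl x≢y
pos-< (there x∈)  | no _   = s<s (pos-< x∈)

nth-pos : ∀ {x xs} → x ∈ xs → nth xs (pos x xs) ≡ x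
nth-pos {x} {y ∷ ys} x∈ with x ≟ y
... | yes refl = refl
nth-pos (here refl) | no x≢y = contradiction refl x≢y
nth-pos (there x∈)  | no _   = nth-pos x∈

pos-nth : ∀ {xs} → Unique xs → ∀ {i} → i < length xs → pos (nth xs i) xs ≡ i
pos-nth {x ∷ xs} _ {zero} _ with x ≟ x
... | yes _   = refl
... | no  x≢x = contradiction refl x≢x
pos-nth {x ∷ xs} (x∉ ∷ u) {suc i} (s≤s l) with nth xs i ≟ x
... | yes eq = contradiction (sym eq) (All.lookup x∉ (nth-∈ xs l))
... | no  _  = cong suc (pos-nth u l)

nth-injective : ∀ {xs} → Unique xs → ∀ {i j} → i < length xs → j < length xs → nth xs i ≡ nth xs j → i ≡ j
nth-injective {xs} u i< j< eq = trans (sym (pos-nth u i<)) (trans (cong (λ x → pos x xs) eq) (pos-nth u j<))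

-- Unordered edges

Edge : Set
Edge = ℕ × ℕ

-- Sorting the ends makes propositional equality the equality of unordered pairs.
edge : ℕ → ℕ → Edge
edge x y = x ⊓ y , x ⊔ y

edge-comm : ∀ x y → edge x y ≡ edge y x
edge-comm x y = cong₂ _,_ (⊓-comm x y) (⊔-comm x y)

edge-sorted : ∀ {x y} → x ≤ y → edge x y ≡ (x , y)
edge-sorted x≤y = cong₂ _,_ (m≤n⇒m⊓n≡m x≤y) (m≤n⇒m⊔n≡n x≤y)

edge-cases : ∀ x y → edge x y ≡ (x , y) ⊎ edge x y ≡ (y , x)
edge-cases x y with ≤-total x y
... | inj₁ x≤y = inj₁ (edge-sorted x≤y)
... | inj₂ y≤x = inj₂ (trans (edge-comm x y) (edge-sorted y≤x))

edge-injective : ∀ {x y z w} → edge x y ≡ edge z w → (x ≡ z × y ≡ w) ⊎ (x ≡ w × y ≡ z)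
edge-injective {x} {y} {z} {w} eq with edge-cases x y | edge-cases z w
... | inj₁ p | inj₁ q with refl ← trans (sym p) (trans eq q) = inj₁ (refl , refl)
... | inj₁ p | inj₂ q with refl ← trans (sym p) (trans eq q) = inj₂ (refl , refl)
... | inj₂ p | inj₁ q with refl ← trans (sym p) (trans eq q) = inj₂ (refl , refl)
... | inj₂ p | inj₂ q with refl ← trans (sym p) (trans eq q) = inj₁ (refl , refl)

edge-cancelˡ : ∀ x {y z} → edge x y ≡ edge x z → y ≡ z
edge-cancelˡ x eq with edge-injective eq
... | inj₁ (_ , y≡z)   = y≡z
... | inj₂ (x≡z , y≡x) = trans y≡x x≡z

_≟ᴱ_ : DecidableEquality Edge
_≟ᴱ_ = ≡-dec _≟_ _≟_

-- Decompositions of edge lists into paths with three edges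

data Path₄ : Set where
  path : (p q r s : ℕ) → Path₄

verts : Path₄ → List ℕ
verts (path p q r s) = p ∷ q ∷ r ∷ s ∷ []

edges : Path₄ → List Edge
edges (path p q r s) = edge p q ∷ edge q r ∷ edge r s ∷ []

IsPath : Path₄ → Set
IsPath = Unique ∘ verts

Decomposable : List Edge → Set
Decomposable E = ∃ λ qs → All IsPath qs × concatMap edges qs ↭ E

length-edges : ∀ qs → 3 ∣ length (concatMap edges qs)
length-edges []                  = 3 ∣0
length-edges (path _ _ _ _ ∷ qs) = ∣m∣n⇒∣m+n ∣-refl (length-edges qs)

decomposable⇒3∣length : ∀ {E} → Decomposable E → 3 ∣ length E
decomposable⇒3∣length (qs , _ , p) = subst (3 ∣_) (↭-length p) (length-edges qs)

concatMap-++ : ∀ qs rs → concatMap edges (qs ++ rs) ≡ concatMap edges qs ++ concatMap edges rs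
concatMap-++ []                  rs = refl
concatMap-++ (path _ _ _ _ ∷ qs) rs = cong (λ E → _ ∷ _ ∷ _ ∷ E) (concatMap-++ qs rs)

-- A decomposable part has a multiple of 3 edges, so divisibility passes from the whole to what
-- remains. The recursion can therefore carry it along without counting edges anew.
peel : ∀ {E F E′} → E ↭ F ++ E′ → Decomposable F → (3 ∣ length E′ → Decomposable E′) →
       3 ∣ length E → Decomposable E
peel {E} {F} {E′} p d@(qs , qs! , pq) rest 3∣E
  with rs , rs! , pr ← rest (∣m+n∣m⇒∣n (subst (3 ∣_) (trans (↭-length p) (length-++ F)) 3∣E) (decomposable⇒3∣length d))
  = qs ++ rs , All.++⁺ qs! rs! ,
    ↭-trans (↭-reflexive (concatMap-++ qs rs)) (↭-trans (++⁺ pq pr) (↭-sym p))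

-- A decomposition found on the labels 0, 1, … is transported along vs.
relabel : List ℕ → Edge → Edge
relabel vs (i , j) = edge (nth vs i) (nth vs j)

relabel-edge : ∀ vs i j → relabel vs (edge i j) ≡ edge (nth vs i) (nth vs j)
relabel-edge vs i j with edge-cases i j
... | inj₁ p = cong (relabel vs) p
... | inj₂ p = trans (cong (relabel vs) p) (edge-comm _ _)

-- The bound keeps labels inside the vertex list, where `nth` is injective and its default value
-- never occurs.
IsPath< : ℕ → Path₄ → Set
IsPath< n q = IsPath q × All (_< n) (verts q)

isPath<? : ∀ n qs → Dec (All (IsPath< n) qs)
isPath<? n = All.all? (λ q → unique? _≟_ (verts q) ×-dec All.all? (_<? n) (verts q))

-- The two implicit checks run on closed numerals and are filled in by evaluation. Transport to
-- actual vertices then needs only that these are distinct, so that simple paths stay simple.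
gadget : (E : List Edge) (qs : List Path₄) (vs : List ℕ) →
         {True (isPath<? (length vs) qs)} → {T (is-just (↭? _≟ᴱ_ (concatMap edges qs) E))} →
         Unique vs → Decomposable (map (relabel vs) E)
gadget E qs vs {ok} {p} u =
  map relabelPath qs , simple qs (toWitness ok) ,
  ↭-trans (↭-reflexive (relabelled qs)) (↭.map⁺ (relabel vs) (to-witness-T _ p))
  where
  relabelPath : Path₄ → Path₄
  relabelPath (path p q r s) = path (nth vs p) (nth vs q) (nth vs r) (nth vs s)

  relabelled : ∀ qs → concatMap edges (map relabelPath qs) ≡ map (relabel vs) (concatMap edges qs)
  relabelled [] = refl
  relabelled (path p q r s ∷ qs) =
    cong₂ _∷_ (sym (relabel-edge vs p q)) (cong₂ _∷_ (sym (relabel-edge vs q r))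
      (cong₂ _∷_ (sym (relabel-edge vs r s)) (relabelled qs)))

  nth-≢ : ∀ {i j} → i < length vs → j < length vs → i ≢ j → nth vs i ≢ nth vs j
  nth-≢ i< j< i≢j = i≢j ∘ nth-injective u i< j<

  unique-map : ∀ {is} → All (_< length vs) is → Unique is → Unique (map (nth vs) is)
  unique-map []         []       = []
  unique-map (i< ∷ is<) (i∉ ∷ v) =
    All.map⁺ (All.tabulate (λ j∈ → nth-≢ i< (All.lookup is< j∈) (All.lookup i∉ j∈))) ∷ unique-map is< v

  simple : ∀ qs → All (IsPath< (length vs)) qs → All IsPath (map relabelPath qs)
  simple []                  []            = []
  simple (path _ _ _ _ ∷ qs) ((v , l) ∷ h) = unique-map l v ∷ simple qs h

-- Closes the cases in which the edge count evaluates to a numeral that 3 does not divide.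
3∤ : ∀ {n} {_ : False (3 ∣? n)} {A : Set} → 3 ∣ n → A
3∤ {_} {f} d = contradiction d (toWitnessFalse f)

-- Graphs as vertex and edge lists, and deletion

edges-unique : ∀ q → IsPath q → Unique (edges q)
edges-unique (path p q r s) ((p≢q ∷ p≢r ∷ p≢s ∷ []) ∷ (q≢r ∷ q≢s ∷ []) ∷ (r≢s ∷ []) ∷ [] ∷ []) =
  (pq≢qr ∷ pq≢rs ∷ []) ∷ (qr≢rs ∷ []) ∷ [] ∷ []
  where
  pq≢qr : edge p q ≢ edge q r
  pq≢qr eq = p≢r (edge-cancelˡ q (trans (edge-comm q p) eq))
  pq≢rs : edge p q ≢ edge r s
  pq≢rs eq with edge-injective eq
  ... | inj₁ (p≡r , _) = p≢r p≡r
  ... | inj₂ (p≡s , _) = p≢s p≡s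
  qr≢rs : edge q r ≢ edge r s
  qr≢rs eq = q≢s (edge-cancelˡ r (trans (edge-comm r q) eq))

-- The vertices are recorded apart from the edges because an isolated vertex still has its two edges
-- to `a` and `b` in the cone.
Spanned : List ℕ → List Edge → Set
Spanned W E = ∀ {e} → e ∈ E → ∃₂ λ x y → x ∈ W × y ∈ W × x ≢ y × e ≡ edge x y

spanned-ends : ∀ {W E x y} → Spanned W E → edge x y ∈ E → x ∈ W × y ∈ W × x ≢ y
spanned-ends v e∈ with v e∈
... | _ , _ , x∈ , y∈ , x≢y , eq with edge-injective eq
...   | inj₁ (refl , refl) = x∈ , y∈ , x≢y
...   | inj₂ (refl , refl) = y∈ , x∈ , x≢y ∘ sym

spanned-≢ : ∀ {W E x y} → Spanned W E → edge x y ∈ E → x ≢ y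
spanned-≢ v = proj₂ ∘ proj₂ ∘ spanned-ends v

flip∈ : ∀ {E : List Edge} x y → edge x y ∈ E → edge y x ∈ E
flip∈ {E} x y = subst (_∈ E) (edge-comm x y)

record Removal (W : List ℕ) (E : List Edge) (xs : List ℕ) (es : List Edge) : Set where
  field
    W′       : List ℕ
    E′       : List Edge
    W↭       : W ↭ xs ++ W′
    E↭       : E ↭ es ++ E′
    spanned′ : Spanned W′ E′
    unique′  : Unique E′

-- By the last hypothesis every edge at a deleted vertex is deleted too. A remaining edge that had
-- lost an end would thus lie in both `es` and `E′`, which are disjoint as `E` has no repetitions.
remove : ∀ {W E} → Spanned W E → Unique E → (xs : List ℕ) (es : List Edge) →
         Unique xs → Unique es → All (_∈ W) xs → All (_∈ E) es →
         All (λ x → ∀ u → edge x u ∈ E → edge x u ∈ es) xs → Removal W E xs es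
remove {W} {E} v u xs es uxs ues xs⊆W es⊆E closed
  with W′ , W↭ ← ⊆⇒↭++ uxs (All.lookup xs⊆W)
  with E′ , E↭ ← ⊆⇒↭++ ues (All.lookup es⊆E)
  with _ , uE′ , disjoint ← Unique-++⁻ es (Unique-resp-↭ E↭ u)
  = record { W′ = W′ ; E′ = E′ ; W↭ = W↭ ; E↭ = E↭ ; spanned′ = v′ ; unique′ = uE′ }
  where
  stays : ∀ {x y} → x ∈ W → edge x y ∈ E′ → x ∈ W′
  stays {x} {y} x∈ e∈ with ∈-++⁻ xs (∈-resp-↭ W↭ x∈)
  ... | inj₁ x∈xs = contradiction
    (All.lookup closed x∈xs y (∈-resp-↭ (↭-sym E↭) (∈-++⁺ʳ es e∈)) , e∈) disjoint
  ... | inj₂ x∈W′ = x∈W′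
  v′ : Spanned W′ E′
  v′ e∈ with v (∈-resp-↭ (↭-sym E↭) (∈-++⁺ʳ es e∈))
  ... | x , y , x∈ , y∈ , x≢y , refl = x , y , stays x∈ e∈ , stays y∈ (flip∈ x y e∈) , x≢y , refl

-- Components of a graph without a three-edge path

HasPath : List Edge → Path₄ → Set
HasPath E q = IsPath q × All (_∈ E) (edges q)

PathFree : List Edge → Set
PathFree E = ∀ q → ¬ HasPath E q

-- Searching the quadruples from `W` is exhaustive, since the ends of every edge lie in `W`.
findPath : ∀ {W E} → Spanned W E → ∃ (HasPath E) ⊎ PathFree E
findPath {W} {E} v with any? (λ p → any? (λ q → any? (λ r → any? (λ s → hasPath? (path p q r s)) W) W) W) W
  where
  hasPath? : ∀ q → Dec (HasPath E q)
  hasPath? q = unique? _≟_ (verts q) ×-dec All.all? (λ e → mem? _≟ᴱ_ e E) (edges q)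
... | yes found = let p , found₁ = satisfied found
                      q , found₂ = satisfied found₁
                      r , found₃ = satisfied found₂
                      s , h      = satisfied found₃
                  in inj₁ (path p q r s , h)
... | no ¬found = inj₂ λ where
  (path p q r s) h@(_ , pq ∷ qr ∷ rs ∷ []) →
    let p∈ , q∈ , _ = spanned-ends v pq
        r∈ , s∈ , _ = spanned-ends v rs
    in ¬found (lose p∈ (lose q∈ (lose r∈ (lose s∈ h))))

neighbour? : ∀ {W E} → Spanned W E → ∀ x y →
             (∃ λ u → u ≢ y × edge x u ∈ E) ⊎ (∀ u → edge x u ∈ E → u ≡ y)
neighbour? {W} {E} v x y with any? (λ u → ¬? (u ≟ y) ×-dec mem? _≟ᴱ_ (edge x u) E) W
... | yes found = inj₁ (satisfied found)
... | no ¬found = inj₂ only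
  where
  only : ∀ u → edge x u ∈ E → u ≡ y
  only u e∈ with u ≟ y
  ... | yes u≡y = u≡y
  ... | no  u≢y = contradiction (lose (proj₁ (proj₂ (spanned-ends v e∈))) (u≢y , e∈)) ¬found

-- Components with edges are triangles or stars. A star is consumed two leaves at a time, its centre
-- staying in the graph; an odd leaf ends as a component with a single edge.
data Piece (W : List ℕ) (E : List Edge) : Set where
  triangle : ∀ x y z → Removal W E (x ∷ y ∷ z ∷ []) (edge x y ∷ edge y z ∷ edge x z ∷ []) → Piece W E
  cherry   : ∀ c x y → c ∈ W → Unique (c ∷ x ∷ y ∷ []) →
             Removal W E (x ∷ y ∷ []) (edge c x ∷ edge c y ∷ []) → Piece W E
  single   : ∀ x y → Removal W E (x ∷ y ∷ []) (edge x y ∷ []) → Piece W E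

module _ {W : List ℕ} {E : List Edge} (v : Spanned W E) (u : Unique E) (free : PathFree E) where

  private
    noPath : ∀ {p q r s} → edge p q ∈ E → edge q r ∈ E → edge r s ∈ E → p ≢ r → p ≢ s → q ≢ s → ∀ {A : Set} → A
    noPath pq qr rs p≢r p≢s q≢s = contradiction
      (((spanned-≢ v pq ∷ p≢r ∷ p≢s ∷ []) ∷ (spanned-≢ v qr ∷ q≢s ∷ []) ∷ (spanned-≢ v rs ∷ []) ∷ [] ∷ []) ,
       pq ∷ qr ∷ rs ∷ []) (free _)

  -- A further edge at x would extend x - y - z to a path with three edges.
  triangle-closed : ∀ {x y z} → edge x y ∈ E → edge y z ∈ E → edge x z ∈ E →
                    ∀ w → edge x w ∈ E → w ≡ y ⊎ w ≡ z
  triangle-closed {x} {y} {z} xy yz xz w xw with w ≟ y | w ≟ z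
  ... | yes w≡y | _       = inj₁ w≡y
  ... | no  _   | yes w≡z = inj₂ w≡z
  ... | no  w≢y | no  w≢z = noPath (flip∈ x w xw) xy yz w≢y w≢z (spanned-≢ v xz)

  -- A further edge at `x` would give the path w - x - c - y.
  leaf-closed : ∀ {c x y} → edge c x ∈ E → edge c y ∈ E → x ≢ y → edge x y ∉ E →
                ∀ w → edge x w ∈ E → w ≡ c
  leaf-closed {c} {x} {y} cx cy x≢y xy∉ w xw with w ≟ c | w ≟ y
  ... | yes w≡c | _        = w≡c
  ... | no  _   | yes refl = contradiction xw xy∉
  ... | no  w≢c | no  w≢y  = noPath (flip∈ x w xw) (flip∈ c x cx) cy w≢c w≢y x≢y

  triangle-piece : ∀ {x y z} → edge x y ∈ E → edge y z ∈ E → edge x z ∈ E → Piece W E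
  triangle-piece {x} {y} {z} xy yz xz = triangle x y z (remove v u _ _ vs! es!
      (proj₁ (spanned-ends v xy) ∷ proj₁ (spanned-ends v yz) ∷ proj₁ (proj₂ (spanned-ends v yz)) ∷ [])
      (xy ∷ yz ∷ xz ∷ [])
      (atx ∷ aty ∷ atz ∷ []))
    where
    x≢y = spanned-≢ v xy
    y≢z = spanned-≢ v yz
    x≢z = spanned-≢ v xz
    vs! : Unique (x ∷ y ∷ z ∷ [])
    vs! = (x≢y ∷ x≢z ∷ []) ∷ (y≢z ∷ []) ∷ [] ∷ []
    es! : Unique (edge x y ∷ edge y z ∷ edge x z ∷ [])
    es! = ((λ eq → x≢z (edge-cancelˡ y (trans (edge-comm y x) eq))) ∷ (y≢z ∘ edge-cancelˡ x) ∷ [])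
        ∷ ((λ eq → x≢y (sym (edge-cancelˡ z (trans (edge-comm z y) (trans eq (edge-comm x z)))))) ∷ [])
        ∷ [] ∷ []
    atx : ∀ w → edge x w ∈ E → edge x w ∈ edge x y ∷ edge y z ∷ edge x z ∷ []
    atx w xw with triangle-closed xy yz xz w xw
    ... | inj₁ refl = here refl
    ... | inj₂ refl = there (there (here refl))
    aty : ∀ w → edge y w ∈ E → edge y w ∈ edge x y ∷ edge y z ∷ edge x z ∷ []
    aty w yw with triangle-closed (flip∈ x y xy) xz yz w yw
    ... | inj₁ refl = here (edge-comm y x)
    ... | inj₂ refl = there (here refl)
    atz : ∀ w → edge z w ∈ E → edge z w ∈ edge x y ∷ edge y z ∷ edge x z ∷ []
    atz w zw with triangle-closed (flip∈ x z xz) xy (flip∈ y z yz) w zw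
    ... | inj₁ refl = there (there (here (edge-comm z x)))
    ... | inj₂ refl = there (here (edge-comm z y))

  cherry-piece : ∀ {c x y} → edge c x ∈ E → edge c y ∈ E → x ≢ y → edge x y ∉ E → Piece W E
  cherry-piece {c} {x} {y} cx cy x≢y xy∉ = cherry c x y (proj₁ (spanned-ends v cx))
      ((spanned-≢ v cx ∷ spanned-≢ v cy ∷ []) ∷ vs!)
      (remove v u _ _ vs! (((x≢y ∘ edge-cancelˡ c) ∷ []) ∷ [] ∷ [])
        (proj₁ (proj₂ (spanned-ends v cx)) ∷ proj₁ (proj₂ (spanned-ends v cy)) ∷ [])
        (cx ∷ cy ∷ []) (atx ∷ aty ∷ []))
    where
    vs! : Unique (x ∷ y ∷ [])
    vs! = (x≢y ∷ []) ∷ [] ∷ []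
    atx : ∀ w → edge x w ∈ E → edge x w ∈ edge c x ∷ edge c y ∷ []
    atx w xw with refl ← leaf-closed cx cy x≢y xy∉ w xw = here (edge-comm x c)
    aty : ∀ w → edge y w ∈ E → edge y w ∈ edge c x ∷ edge c y ∷ []
    aty w yw with refl ← leaf-closed cy cx (x≢y ∘ sym) (xy∉ ∘ flip∈ y x) w yw = there (here (edge-comm y c))

  piece : ∀ {x y} → edge x y ∈ E → Piece W E
  piece {x} {y} xy with neighbour? v x y
  ... | inj₁ (z , z≢y , xz) with mem? _≟ᴱ_ (edge y z) E
  ...   | yes yz  = triangle-piece xy yz xz
  ...   | no  yz∉ = cherry-piece xy xz (z≢y ∘ sym) yz∉
  piece {x} {y} xy | inj₂ onlyx with neighbour? v y x
  ... | inj₁ (z , z≢x , yz) =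
    -- The centre is `y`. No edge joins `x` to `z`, because `y` is the only neighbour of `x`.
    cherry-piece (flip∈ x y xy) yz (z≢x ∘ sym) (spanned-≢ v yz ∘ sym ∘ onlyx z)
  ... | inj₂ onlyy = single x y (remove v u _ _ vs! ([] ∷ [])
      (proj₁ (spanned-ends v xy) ∷ proj₁ (proj₂ (spanned-ends v xy)) ∷ []) (xy ∷ []) (atx ∷ aty ∷ []))
    where
    vs! : Unique (x ∷ y ∷ [])
    vs! = (spanned-≢ v xy ∷ []) ∷ [] ∷ []
    atx : ∀ w → edge x w ∈ E → edge x w ∈ edge x y ∷ []
    atx w xw with refl ← onlyx w xw = here refl
    aty : ∀ w → edge y w ∈ E → edge y w ∈ edge x y ∷ []
    aty w yw with refl ← onlyy w yw = here (edge-comm y x)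

-- Decomposing the join of the edge ab with a graph

module Cone (a b : ℕ) where

  open import Algebra.Solver.CommutativeMonoid (++-commutativeMonoid {A = Edge}) using (solve; _⊜_; _⊕_)

  -- The complete bipartite graph between `a`, `b` and the list, ordered by vertex so that
  -- concatenating vertex lists concatenates the edge lists.
  join : List ℕ → List Edge
  join []       = []
  join (x ∷ xs) = edge a x ∷ edge b x ∷ join xs

  pendingVerts : Maybe (ℕ × ℕ) → List ℕ
  pendingVerts nothing        = []
  pendingVerts (just (p , q)) = p ∷ q ∷ []

  pending : Maybe (ℕ × ℕ) → List Edge
  pending nothing        = []
  pending (just (p , q)) = edge p q ∷ join (p ∷ q ∷ [])

  -- The pending edge pq is an isolated edge of the graph, set aside to be paired with the next one.
  cone : Maybe (ℕ × ℕ) → List ℕ → List Edge → List Edge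
  cone M W E = edge a b ∷ pending M ++ join W ++ E

  join-↭ : ∀ {xs ys} → xs ↭ ys → join xs ↭ join ys
  join-↭ ↭.refl           = ↭-refl
  join-↭ (↭.prep x p)     = ↭-prep _ (↭-prep _ (join-↭ p))
  join-↭ (↭.swap {xs} {ys} x y p) = ↭-trans
    (solve 3 (λ X Y R → (X ⊕ (Y ⊕ R)) ⊜ (Y ⊕ (X ⊕ R))) ↭-refl (join (x ∷ [])) (join (y ∷ [])) (join xs))
    (++⁺ˡ (join (y ∷ x ∷ [])) (join-↭ p))
  join-↭ (↭.trans p q)    = ↭-trans (join-↭ p) (join-↭ q)

  join-++ : ∀ xs ys → join (xs ++ ys) ≡ join xs ++ join ys
  join-++ []       ys = refl
  join-++ (x ∷ xs) ys = cong (λ E → _ ∷ _ ∷ E) (join-++ xs ys)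

  join-split : ∀ {W} xs {W′} → W ↭ xs ++ W′ → join W ↭ join xs ++ join W′
  join-split xs {W′} p = ↭-trans (join-↭ p) (↭-reflexive (join-++ xs W′))

  -- Serves every removal: with `xs` empty it splits off a path of the graph, with `es` empty a set
  -- of isolated vertices.
  cone-split : ∀ M {W E} xs {W′} es {E′} → W ↭ xs ++ W′ → E ↭ es ++ E′ →
               cone M W E ↭ (es ++ join xs) ++ cone M W′ E′
  cone-split M xs {W′} es {E′} p q = ↭-trans
    (↭-prep _ (++⁺ˡ (pending M) (++⁺ (join-split xs p) q)))
    (solve 6 (λ ab m x w e f → (ab ⊕ (m ⊕ ((x ⊕ w) ⊕ (e ⊕ f)))) ⊜ ((e ⊕ x) ⊕ (ab ⊕ (m ⊕ (w ⊕ f)))))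
       ↭-refl (edge a b ∷ []) (pending M) (join xs) (join W′) es E′)

  -- In all gadgets the labels 0 and 1 stand for `a` and `b`, the later ones for the other vertices
  -- in order. Here K_{2,3} splits as a-x-b-y, y-a-z-b.
  triple-gadget : ∀ {x y z} → Unique (a ∷ b ∷ x ∷ y ∷ z ∷ []) → Decomposable (join (x ∷ y ∷ z ∷ []))
  triple-gadget = gadget ((0 , 2) ∷ (1 , 2) ∷ (0 , 3) ∷ (1 , 3) ∷ (0 , 4) ∷ (1 , 4) ∷ [])
                         (path 0 2 1 3 ∷ path 3 0 4 1 ∷ []) (a ∷ b ∷ _ ∷ _ ∷ _ ∷ [])

  triangle-gadget : ∀ {x y z} → Unique (a ∷ b ∷ x ∷ y ∷ z ∷ []) →
                    Decomposable (edge x y ∷ edge y z ∷ edge x z ∷ join (x ∷ y ∷ z ∷ []))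
  triangle-gadget =
    gadget ((2 , 3) ∷ (3 , 4) ∷ (2 , 4) ∷ (0 , 2) ∷ (1 , 2) ∷ (0 , 3) ∷ (1 , 3) ∷ (0 , 4) ∷ (1 , 4) ∷ [])
           (path 0 2 3 1 ∷ path 0 3 4 1 ∷ path 0 4 2 1 ∷ []) (a ∷ b ∷ _ ∷ _ ∷ _ ∷ [])

  -- The paths c-x-a-y and c-y-b-x use the join edges of the leaves only, so the centre keeps its
  -- own.
  cherry-gadget : ∀ {c x y} → Unique (a ∷ b ∷ c ∷ x ∷ y ∷ []) →
                  Decomposable (edge c x ∷ edge c y ∷ join (x ∷ y ∷ []))
  cherry-gadget = gadget ((2 , 3) ∷ (2 , 4) ∷ (0 , 3) ∷ (1 , 3) ∷ (0 , 4) ∷ (1 , 4) ∷ [])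
                         (path 2 3 0 4 ∷ path 2 4 1 3 ∷ []) (a ∷ b ∷ _ ∷ _ ∷ _ ∷ [])

  -- The paths x-y-a-q and p-q-b-y consume the join edges of `y` and `q`; the ends `x` and `p`
  -- survive as isolated vertices.
  twoEdges-gadget : ∀ {x y p q} → Unique (a ∷ b ∷ x ∷ y ∷ p ∷ q ∷ []) →
                    Decomposable (edge x y ∷ edge p q ∷ join (y ∷ q ∷ []))
  twoEdges-gadget = gadget ((2 , 3) ∷ (4 , 5) ∷ (0 , 3) ∷ (1 , 3) ∷ (0 , 5) ∷ (1 , 5) ∷ [])
                           (path 2 3 0 5 ∷ path 4 5 1 3 ∷ []) (a ∷ b ∷ _ ∷ _ ∷ _ ∷ _ ∷ [])

  cone-four : ∀ {x y z t} → Unique (a ∷ b ∷ x ∷ y ∷ z ∷ t ∷ []) →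
              Decomposable (cone nothing (x ∷ y ∷ z ∷ t ∷ []) [])
  cone-four = gadget ((0 , 1) ∷ (0 , 2) ∷ (1 , 2) ∷ (0 , 3) ∷ (1 , 3) ∷ (0 , 4) ∷ (1 , 4) ∷ (0 , 5) ∷ (1 , 5) ∷ [])
                     (path 2 0 1 3 ∷ path 2 1 4 0 ∷ path 3 0 5 1 ∷ []) (a ∷ b ∷ _ ∷ _ ∷ _ ∷ _ ∷ [])

  cone-edge : ∀ {p q} → Unique (a ∷ b ∷ p ∷ q ∷ []) → Decomposable (cone (just (p , q)) [] [])
  cone-edge = gadget ((0 , 1) ∷ (2 , 3) ∷ (0 , 2) ∷ (1 , 2) ∷ (0 , 3) ∷ (1 , 3) ∷ [])
                     (path 0 1 2 3 ∷ path 2 0 3 1 ∷ []) (a ∷ b ∷ _ ∷ _ ∷ [])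

  -- Splitting off the cherry alone would leave the triangle a, b, c, which contains no path with
  -- three edges; the two are therefore decomposed together.
  cone-cherry : ∀ {c x y} → Unique (a ∷ b ∷ c ∷ x ∷ y ∷ []) →
                Decomposable ((edge c x ∷ edge c y ∷ join (x ∷ y ∷ [])) ++ cone nothing (c ∷ []) [])
  cone-cherry = gadget ((2 , 3) ∷ (2 , 4) ∷ (0 , 3) ∷ (1 , 3) ∷ (0 , 4) ∷ (1 , 4) ∷ (0 , 1) ∷ (0 , 2) ∷ (1 , 2) ∷ [])
                       (path 0 1 2 3 ∷ path 0 2 4 1 ∷ path 1 3 0 4 ∷ []) (a ∷ b ∷ _ ∷ _ ∷ _ ∷ [])

  -- The same precaution for a last triangle that would leave a, b, t.
  cone-triangle : ∀ {x y z t} → Unique (a ∷ b ∷ x ∷ y ∷ z ∷ t ∷ []) →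
                  Decomposable ((edge x y ∷ edge y z ∷ edge x z ∷ join (x ∷ y ∷ z ∷ [])) ++ cone nothing (t ∷ []) [])
  cone-triangle =
    gadget ((2 , 3) ∷ (3 , 4) ∷ (2 , 4) ∷ (0 , 2) ∷ (1 , 2) ∷ (0 , 3) ∷ (1 , 3) ∷ (0 , 4) ∷ (1 , 4)
             ∷ (0 , 1) ∷ (0 , 5) ∷ (1 , 5) ∷ [])
           (path 0 1 2 3 ∷ path 0 2 4 1 ∷ path 0 3 1 5 ∷ path 3 4 0 5 ∷ []) (a ∷ b ∷ _ ∷ _ ∷ _ ∷ _ ∷ [])

  Distinct : Maybe (ℕ × ℕ) → List ℕ → Set
  Distinct M W = Unique (a ∷ b ∷ pendingVerts M ++ W)

  -- Excludes the triangle a, b, t, which is left over when nothing is pending and W = [ t ].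
  Large : Maybe (ℕ × ℕ) → List ℕ → Set
  Large nothing  W = 2 ≤ length W
  Large (just _) W = ⊤

  large-resp-↭ : ∀ M {W W′} → W ↭ W′ → Large M W → Large M W′
  large-resp-↭ nothing  p l = subst (2 ≤_) (↭-length p) l
  large-resp-↭ (just _) p l = tt

  distinct-resp-↭ : ∀ M {W W′} → W ↭ W′ → Distinct M W → Distinct M W′
  distinct-resp-↭ M p = Unique-resp-↭ (↭-prep a (↭-prep b (++⁺ˡ (pendingVerts M) p)))

  distinct-split : ∀ M {W} xs {W′} → W ↭ xs ++ W′ → Distinct M W → Unique (a ∷ b ∷ xs) × Distinct M W′
  distinct-split M {W} xs {W′} p d =
    proj₁ (Unique-++⁻ (a ∷ b ∷ xs) d₁) ,
    proj₁ (proj₂ (Unique-++⁻ xs (Unique-resp-↭ (shifts (a ∷ b ∷ []) xs) d₁)))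
    where
    d₁ : Unique (a ∷ b ∷ xs ++ (pendingVerts M ++ W′))
    d₁ = Unique-resp-↭ (↭-prep a (↭-prep b (↭-trans (++⁺ˡ (pendingVerts M) p) (shifts (pendingVerts M) xs)))) d

  decomposable-resp-↭ : ∀ {E F} → E ↭ F → Decomposable F → Decomposable E
  decomposable-resp-↭ p (qs , qs! , q) = qs , qs! , ↭-trans q (↭-sym p)

  3∣-resp-↭ : ∀ {E F : List Edge} → E ↭ F → 3 ∣ length E → 3 ∣ length F
  3∣-resp-↭ p = subst (3 ∣_) (↭-length p)

  -- With m vertices in `W` there are 2m + 1 edges, or 2m + 6 if one is pending, so m is 1 or 0
  -- modulo 3 respectively. Removing three vertices at a time ends at m = 4, since `Large` rules out
  -- m = 1, or at m = 0.
  edgeless-cone : ∀ M W → Distinct M W → Large M W → 3 ∣ length (cone M W []) → Decomposable (cone M W [])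
  edgeless-cone nothing (_ ∷ _ ∷ [])             d l 3∣ = 3∤ 3∣
  edgeless-cone nothing (_ ∷ _ ∷ _ ∷ [])         d l 3∣ = 3∤ 3∣
  edgeless-cone nothing (_ ∷ _ ∷ _ ∷ _ ∷ [])     d l 3∣ = cone-four d
  edgeless-cone nothing (x ∷ y ∷ z ∷ W@(_ ∷ _ ∷ _)) d l 3∣ =
    let d₁ , d₂ = distinct-split nothing (x ∷ y ∷ z ∷ []) ↭-refl d in
    peel (cone-split nothing (x ∷ y ∷ z ∷ []) {W} [] {[]} ↭-refl ↭-refl) (triple-gadget d₁)
         (edgeless-cone nothing W d₂ (s≤s (s≤s z≤n))) 3∣
  edgeless-cone (just _) []            d l 3∣ = cone-edge d
  edgeless-cone (just _) (_ ∷ [])      d l 3∣ = 3∤ 3∣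
  edgeless-cone (just _) (_ ∷ _ ∷ [])  d l 3∣ = 3∤ 3∣
  edgeless-cone M@(just _) (x ∷ y ∷ z ∷ W) d l 3∣ =
    let d₁ , d₂ = distinct-split M (x ∷ y ∷ z ∷ []) ↭-refl d in
    peel (cone-split M (x ∷ y ∷ z ∷ []) {W} [] {[]} ↭-refl ↭-refl) (triple-gadget d₁) (edgeless-cone M W d₂ tt) 3∣
  edgeless-cone nothing []      d () 3∣
  edgeless-cone nothing (_ ∷ []) d (s≤s ()) 3∣

  spanned-[] : ∀ {E} → Spanned [] E → E ≡ []
  spanned-[] {[]}    v = refl
  spanned-[] {e ∷ _} v with v (here refl)
  ... | _ , _ , () , _

  spanned-[t] : ∀ {t E} → Spanned (t ∷ []) E → E ≡ []
  spanned-[t] {E = []}    v = refl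
  spanned-[t] {E = e ∷ _} v with v (here refl)
  ... | _ , _ , here refl , here refl , x≢y , _ = contradiction refl x≢y

  shorter : ∀ {n} (es : List Edge) {{_ : NonZero (length es)}} {E E′ : List Edge} →
            length E ≤ suc n → E ↭ es ++ E′ → length E′ ≤ n
  shorter (_ ∷ es) {E′ = E′} E≤ p = ≤-trans (m≤n+m (length E′) (length es))
    (s≤s⁻¹ (subst (_≤ suc _) (trans (↭-length p) (cong suc (length-++ es))) E≤))

  -- The bound `n` on the number of edges of the graph makes the mutual recursion structural: each
  -- path or piece stripped takes at least one of them.
  cone-decomposable : ∀ n M W E → length E ≤ n → Distinct M W → Large M W → Spanned W E → Unique E →
                      3 ∣ length (cone M W E) → Decomposable (cone M W E)

  strip-path : ∀ n M {W E} q → IsPath q → Removal W E [] (edges q) → length E ≤ suc n → Distinct M W → Large M W →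
               3 ∣ length (cone M W E) → Decomposable (cone M W E)
  strip-path n M q@(path _ _ _ _) q! r E≤ d l =
    peel (cone-split M [] (edges q) W↭ E↭) (q ∷ [] , q! ∷ [] , ↭-refl)
         (cone-decomposable n M W′ E′ (shorter (edges q) E≤ E↭) (distinct-resp-↭ M W↭ d) (large-resp-↭ M W↭ l) spanned′ unique′)
    where open Removal r

  -- With nothing pending, `Large` must survive the removal; where too few vertices would be left,
  -- the whole cone is settled at once. A single edge is set aside, or resolved against the one
  -- already pending.
  strip-piece : ∀ n M {W E} → Piece W E → length E ≤ suc n → Distinct M W → Large M W →
                3 ∣ length (cone M W E) → Decomposable (cone M W E)
  strip-piece n M {W} {E} (triangle x y z r) E≤ d l 3∣ =
    finish M W′ E′ d l 3∣ W↭ E↭ spanned′ unique′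
    where
    open Removal r
    xs = x ∷ y ∷ z ∷ []
    es = edge x y ∷ edge y z ∷ edge x z ∷ []
    -- The fields of the removal become variables here, so that `W′` can be split and `E′` unified
    -- with the empty list.
    finish : ∀ M W′ E′ → Distinct M W → Large M W → 3 ∣ length (cone M W E) → W ↭ xs ++ W′ → E ↭ es ++ E′ →
             Spanned W′ E′ → Unique E′ → Decomposable (cone M W E)
    finish nothing [] E′ d l 3∣ p q v u with refl ← spanned-[] v =
      -- Only ab would be left beside the nine edges of the triangle and its join, ten in all.
      3∤ (3∣-resp-↭ (cone-split nothing xs es p q) 3∣)
    finish nothing (t ∷ []) E′ d l 3∣ p q v u with refl ← spanned-[t] v =
      decomposable-resp-↭ (cone-split nothing xs es p q) (cone-triangle (distinct-resp-↭ nothing p d))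
    finish nothing W′@(_ ∷ _ ∷ _) E′ d l 3∣ p q v u with d₁ , d₂ ← distinct-split nothing xs p d =
      peel (cone-split nothing xs es p q) (triangle-gadget d₁)
           (cone-decomposable n nothing W′ E′ (shorter es E≤ q) d₂ (s≤s (s≤s z≤n)) v u) 3∣
    finish M@(just _) W′ E′ d l 3∣ p q v u with d₁ , d₂ ← distinct-split M xs p d =
      peel (cone-split M xs es p q) (triangle-gadget d₁)
           (cone-decomposable n M W′ E′ (shorter es E≤ q) d₂ tt v u) 3∣
  strip-piece n M {W} {E} (cherry c x y c∈ ((c≢x ∷ c≢y ∷ []) ∷ _) r) E≤ d l 3∣
    -- The centre survives the removal of `x` and `y`. Moving it to the front makes an empty `W″`
    -- the case where nothing else survives.
    with W″ , cW″ ← ∈⇒↭∷ (∈-∷⁻ (c≢y ∘ sym) (∈-∷⁻ (c≢x ∘ sym) (∈-resp-↭ (Removal.W↭ r) c∈))) =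
    finish M W″ E′ d l 3∣ (↭-trans W↭ (++⁺ˡ (x ∷ y ∷ []) cW″)) E↭ (spanned-resp-↭ cW″ spanned′) unique′
    where
    open Removal r
    xs = x ∷ y ∷ []
    es = edge c x ∷ edge c y ∷ []
    spanned-resp-↭ : ∀ {W W′ E} → W ↭ W′ → Spanned W E → Spanned W′ E
    spanned-resp-↭ p v e∈ with x , y , x∈ , y∈ , rest ← v e∈ = x , y , ∈-resp-↭ p x∈ , ∈-resp-↭ p y∈ , rest
    c-first : ∀ W″ → xs ++ c ∷ W″ ↭ c ∷ xs ++ W″
    c-first W″ = shift c xs W″
    cxy! : ∀ M W″ → Distinct M W → W ↭ xs ++ c ∷ W″ → Unique (a ∷ b ∷ c ∷ xs)
    cxy! M W″ d p = proj₁ (distinct-split M (c ∷ xs) (↭-trans p (c-first W″)) d)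
    finish : ∀ M W″ E′ → Distinct M W → Large M W → 3 ∣ length (cone M W E) → W ↭ xs ++ c ∷ W″ → E ↭ es ++ E′ →
             Spanned (c ∷ W″) E′ → Unique E′ → Decomposable (cone M W E)
    finish nothing [] E′ d l 3∣ p q v u with refl ← spanned-[t] v =
      decomposable-resp-↭ (cone-split nothing xs es p q) (cone-cherry (cxy! nothing [] d p))
    finish nothing W″@(_ ∷ _) E′ d l 3∣ p q v u =
      peel (cone-split nothing xs es p q) (cherry-gadget (cxy! nothing W″ d p))
           (cone-decomposable n nothing (c ∷ W″) E′ (shorter es E≤ q) (proj₂ (distinct-split nothing xs p d))
             (s≤s (s≤s z≤n)) v u) 3∣
    finish M@(just _) W″ E′ d l 3∣ p q v u =
      peel (cone-split M xs es p q) (cherry-gadget (cxy! M W″ d p))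
           (cone-decomposable n M (c ∷ W″) E′ (shorter es E≤ q) (proj₂ (distinct-split M xs p d)) tt v u) 3∣
  strip-piece n nothing {W} {E} (single x y r) E≤ d l 3∣ =
    -- The cone is only reordered, but its graph part loses an edge, so the bound decreases.
    decomposable-resp-↭ suspend
      (cone-decomposable n (just (x , y)) W′ E′ (shorter (edge x y ∷ []) E≤ E↭) (distinct-resp-↭ nothing W↭ d) tt spanned′ unique′
        (3∣-resp-↭ suspend 3∣))
    where
    open Removal r
    suspend : cone nothing W E ↭ cone (just (x , y)) W′ E′
    suspend = ↭-prep _ (↭-trans (++⁺ (join-split (x ∷ y ∷ []) W↭) E↭)
      (solve 4 (λ j w e f → ((j ⊕ w) ⊕ (e ⊕ f)) ⊜ ((e ⊕ j) ⊕ (w ⊕ f)))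
         ↭-refl (join (x ∷ y ∷ [])) (join W′) (edge x y ∷ []) E′))
  strip-piece n (just (p , q)) {W} {E} (single x y r) E≤ d l 3∣ =
    peel release (twoEdges-gadget (proj₁ (Unique-++⁻ (a ∷ b ∷ x ∷ y ∷ p ∷ q ∷ []) d₁)))
      -- The returning ends `x` and `p` alone make the vertex list long enough for `Large`.
      (cone-decomposable n nothing (x ∷ p ∷ W′) E′ (shorter (edge x y ∷ []) E≤ E↭)
        (proj₂ (distinct-split nothing (y ∷ q ∷ []) yq-first d₁)) (s≤s (s≤s z≤n))
        (λ e∈ → let s , t , s∈ , t∈ , rest = spanned′ e∈ in s , t , there (there s∈) , there (there t∈) , rest)
        unique′) 3∣
    where
    open Removal r
    d₁ : Distinct nothing (x ∷ y ∷ p ∷ q ∷ W′)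
    d₁ = Unique-resp-↭ (↭-prep a (↭-prep b
      (↭-trans (++⁺ˡ (p ∷ q ∷ []) W↭) (shifts (p ∷ q ∷ []) (x ∷ y ∷ []))))) d
    yq-first : x ∷ y ∷ p ∷ q ∷ W′ ↭ (y ∷ q ∷ []) ++ x ∷ p ∷ W′
    yq-first = ↭-trans (↭-swap x y (↭-swap p q ↭-refl)) (↭-prep y (↭-swap x q ↭-refl))
    release : cone (just (p , q)) W E ↭
              (edge x y ∷ edge p q ∷ join (y ∷ q ∷ [])) ++ cone nothing (x ∷ p ∷ W′) E′
    release = ↭-trans (↭-prep _ (++⁺ˡ (pending (just (p , q))) (++⁺ (join-split (x ∷ y ∷ []) W↭) E↭)))
      (solve 9 (λ ab pq jp jq jx jy w xy f →
           (ab ⊕ ((pq ⊕ (jp ⊕ jq)) ⊕ (((jx ⊕ jy) ⊕ w) ⊕ (xy ⊕ f)))) ⊜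
           ((xy ⊕ (pq ⊕ (jy ⊕ jq))) ⊕ (ab ⊕ ((jx ⊕ (jp ⊕ w)) ⊕ f))))
         ↭-refl (edge a b ∷ []) (edge p q ∷ []) (join (p ∷ [])) (join (q ∷ [])) (join (x ∷ [])) (join (y ∷ []))
         (join W′) (edge x y ∷ []) E′)

  cone-decomposable _ M W [] _ d l v u 3∣ = edgeless-cone M W d l 3∣
  cone-decomposable (suc n) M W E@(_ ∷ _) E≤ d l v u 3∣ with findPath v | v (here refl)
  ... | inj₁ (q , q! , q⊆E) | _ =
    strip-path n M q q! (remove v u [] (edges q) [] (edges-unique q q!) [] q⊆E []) E≤ d l 3∣
  ... | inj₂ free | x , y , _ , _ , _ , refl = strip-piece n M (piece v u free (here refl)) E≤ d l 3∣

-- Edge lists of path systems and of complete graphs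

∈-concatMap-edges : ∀ qs i {e} → e ∈ edges (lookup qs i) → e ∈ concatMap edges qs
∈-concatMap-edges qs i e∈ = ∈-concatMap⁺ edges {xs = qs} (lose (∈-lookup {xs = qs} i) e∈)

-- Gives both that the blocks of the path design are distinct and that each edge lies in only one of
-- them.
concatMap-edges-injective : ∀ {qs} → Unique (concatMap edges qs) → ∀ i j {e} →
                            e ∈ edges (lookup qs i) → e ∈ edges (lookup qs j) → i ≡ j
concatMap-edges-injective {q ∷ qs} u zero    zero    _  _  = refl
concatMap-edges-injective {q ∷ qs} u zero    (suc j) e∈ e∈′ =
  contradiction (e∈ , ∈-concatMap-edges qs j e∈′) (proj₂ (proj₂ (Unique-++⁻ (edges q) u)))
concatMap-edges-injective {q ∷ qs} u (suc i) zero    e∈ e∈′ =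
  contradiction (e∈′ , ∈-concatMap-edges qs i e∈) (proj₂ (proj₂ (Unique-++⁻ (edges q) u)))
concatMap-edges-injective {q ∷ qs} u (suc i) (suc j) e∈ e∈′ =
  cong suc (concatMap-edges-injective {qs} (proj₁ (proj₂ (Unique-++⁻ (edges q) u))) i j e∈ e∈′)

pairs : List ℕ → List Edge
pairs []       = []
pairs (x ∷ xs) = map (edge x) xs ++ pairs xs

∈-pairs⁺ : ∀ {x y xs} → x ∈ xs → y ∈ xs → x ≢ y → edge x y ∈ pairs xs
∈-pairs⁺ (here refl) (here refl) x≢y = contradiction refl x≢y
∈-pairs⁺ (here refl) (there y∈)  x≢y = ∈-++⁺ˡ (∈-map⁺ _ y∈)
∈-pairs⁺ {x} {y} (there x∈) (here refl) x≢y = ∈-++⁺ˡ (subst (_∈ map (edge y) _) (edge-comm y x) (∈-map⁺ (edge y) x∈))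
∈-pairs⁺ (there x∈)  (there y∈)  x≢y = ∈-++⁺ʳ _ (∈-pairs⁺ x∈ y∈ x≢y)

pairs-spanned : ∀ {xs} → Unique xs → Spanned xs (pairs xs)
pairs-spanned {x ∷ xs} (x∉ ∷ u) e∈ with ∈-++⁻ (map (edge x) xs) e∈
... | inj₁ e∈ˡ with y , y∈ , eq ← ∈-map⁻ (edge x) e∈ˡ = x , y , here refl , there y∈ , All.lookup x∉ y∈ , eq
... | inj₂ e∈ʳ with y , z , y∈ , z∈ , y≢z , eq ← pairs-spanned u e∈ʳ = y , z , there y∈ , there z∈ , y≢z , eq

pairs-unique : ∀ {xs} → Unique xs → Unique (pairs xs)
pairs-unique [] = []
pairs-unique {x ∷ xs} (x∉ ∷ u) = Unique-++⁺ (Unique-map⁺ (edge-cancelˡ x) u) (pairs-unique u) disjoint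
  where
  disjoint : Disjoint (map (edge x) xs) (pairs xs)
  disjoint (e∈ˡ , e∈ʳ) with _ , _ , refl ← ∈-map⁻ (edge x) e∈ˡ =
    All.lookup x∉ (proj₁ (spanned-ends (pairs-spanned u) e∈ʳ)) refl

-- Induction in steps of three: three vertices added to m others bring 3m + 3 edges, and the residue
-- of the length is unchanged by computation.
3∣length-pairs : ∀ xs → length xs % 3 ≡ 0 ⊎ length xs % 3 ≡ 1 → 3 ∣ length (pairs xs)
3∣length-pairs []              _ = 3 ∣0
3∣length-pairs (_ ∷ [])        _ = 3 ∣0
3∣length-pairs (_ ∷ _ ∷ [])    (inj₁ ())
3∣length-pairs (_ ∷ _ ∷ [])    (inj₂ ())
3∣length-pairs (x ∷ y ∷ z ∷ xs) h = subst (3 ∣_) (sym count)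
  (∣m∣n⇒∣m+n (n∣m*n (suc (length xs))) (3∣length-pairs xs h))
  where
  length-pairs-∷ : ∀ x xs → length (pairs (x ∷ xs)) ≡ length xs + length (pairs xs)
  length-pairs-∷ x xs = trans (length-++ (map (edge x) xs)) (cong (_+ _) (length-map (edge x) xs))
  open +-*-Solver
  count : length (pairs (x ∷ y ∷ z ∷ xs)) ≡ suc (length xs) * 3 + length (pairs xs)
  count rewrite length-pairs-∷ x (y ∷ z ∷ xs) | length-pairs-∷ y (z ∷ xs) | length-pairs-∷ z xs =
    solve 2 (λ n t → (con 2 :+ n) :+ ((con 1 :+ n) :+ (n :+ t)) := (con 1 :+ n) :* con 3 :+ t)
      refl (length xs) (length (pairs xs))

-- Isomorphisms, complete graphs and path graphs

≅-sym : ∀ {G H} → G ≅ H → H ≅ G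
≅-sym i = record
  { to = from ; from = to ; to-∈ = from-∈ ; from-∈ = to-∈
  ; from∘to = to∘from ; to∘from = from∘to ; to-adj = from-adj ; from-adj = to-adj }
  where open _≅_ i

≅-refl : ∀ {G} → G ≅ G
≅-refl = record
  { to = id ; from = id ; to-∈ = id ; from-∈ = id
  ; from∘to = λ _ → refl ; to∘from = λ _ → refl ; to-adj = id ; from-adj = id }

≅⇒length≤ : ∀ {G H} → G ≅ H → length (vertices G) ≤ length (vertices H)
≅⇒length≤ {G} {H} i = subst (_ ≤_) (length-map from (vertices H))
  (⊆⇒length≤ (unique G) λ x∈ → subst (_∈ _) (from∘to x∈) (∈-map⁺ from (to-∈ x∈)))
  where open _≅_ i

-- Positions in the vertex list supply the bijection, which leaves only adjacency to be checked.
≅-enumerate : ∀ G H → vertices H ≡ upTo (length (vertices G)) →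
              (∀ {x y} → Adj G x y → Adj H (pos x (vertices G)) (pos y (vertices G))) →
              (∀ {i j} → Adj H i j → Adj G (nth (vertices G) i) (nth (vertices G) j)) → G ≅ H
≅-enumerate G H eq to-adj from-adj = record
  { to       = λ x → pos x (vertices G)
  ; from     = nth (vertices G)
  ; to-∈     = λ x∈ → subst (_ ∈_) (sym eq) (∈-upTo⁺ (pos-< x∈))
  ; from-∈   = λ i∈ → nth-∈ (vertices G) (bound i∈)
  ; from∘to  = nth-pos
  ; to∘from  = λ i∈ → pos-nth (unique G) (bound i∈)
  ; to-adj   = to-adj
  ; from-adj = from-adj
  }
  where
  bound : ∀ {i} → i ∈ vertices H → i < length (vertices G)
  bound i∈ = ∈-upTo⁻ (subst (_ ∈_) eq i∈)

complete : ∀ T → Unique T → Graph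
complete T u = record
  { vertices = T
  ; unique   = u
  ; Adj      = λ x y → x ∈ T × y ∈ T × x ≢ y
  ; adj?     = λ x y → mem? _≟_ x T ×-dec mem? _≟_ y T ×-dec ¬? (x ≟ y)
  ; adj-sym  = λ (x∈ , y∈ , x≢y) → y∈ , x∈ , x≢y ∘ sym
  ; loopless = λ (_ , _ , x≢x) → x≢x refl
  ; adj-∈    = proj₁
  }

complete≅K : ∀ T u → complete T u ≅ K (length T)
complete≅K T u = ≅-enumerate (complete T u) (K (length T)) refl
  (λ (x∈ , y∈ , x≢y) → ∈-upTo⁺ (pos-< x∈) , ∈-upTo⁺ (pos-< y∈) ,
    (λ eq → x≢y (trans (sym (nth-pos x∈)) (trans (cong (nth T) eq) (nth-pos y∈)))) , inj₁ tt)
  (λ (i∈ , j∈ , i≢j , _) → nth-∈ T (∈-upTo⁻ i∈) , nth-∈ T (∈-upTo⁻ j∈) ,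
    λ eq → i≢j (nth-injective u (∈-upTo⁻ i∈) (∈-upTo⁻ j∈) eq))

edges⇒verts : ∀ q {x y} → edge x y ∈ edges q → x ∈ verts q
edges⇒verts (path p q r s) (here eq) with edge-injective eq
... | inj₁ (refl , _) = here refl
... | inj₂ (refl , _) = there (here refl)
edges⇒verts (path p q r s) (there (here eq)) with edge-injective eq
... | inj₁ (refl , _) = there (here refl)
... | inj₂ (refl , _) = there (there (here refl))
edges⇒verts (path p q r s) (there (there (here eq))) with edge-injective eq
... | inj₁ (refl , _) = there (there (here refl))
... | inj₂ (refl , _) = there (there (there (here refl)))

edges-≢ : ∀ q → IsPath q → ∀ {x} → edge x x ∉ edges q
edges-≢ (path p q r s) ((p≢q ∷ _) ∷ (q≢r ∷ _) ∷ (r≢s ∷ _) ∷ _) {x} = λ where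
    (here eq)                 → loop p≢q eq
    (there (here eq))         → loop q≢r eq
    (there (there (here eq))) → loop r≢s eq
  where
  loop : ∀ {y z} → y ≢ z → edge x x ≢ edge y z
  loop y≢z eq with edge-injective eq
  ... | inj₁ (refl , refl) = y≢z refl
  ... | inj₂ (refl , refl) = y≢z refl

pathGraph : ∀ q → IsPath q → Graph
pathGraph q q! = record
  { vertices = verts q
  ; unique   = q!
  ; Adj      = λ x y → edge x y ∈ edges q
  ; adj?     = λ x y → mem? _≟ᴱ_ (edge x y) (edges q)
  ; adj-sym  = λ {x} {y} → flip∈ x y
  ; loopless = edges-≢ q q!
  ; adj-∈    = edges⇒verts q
  }

pathGraph≅P : ∀ q q! → pathGraph q q! ≅ P 4
pathGraph≅P t@(path p q r s) t! = ≅-enumerate (pathGraph t t!) (P 4) (vertices-≡ t) to-adj from-adj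
  where
  vertices-≡ : ∀ t → upTo 4 ≡ upTo (length (verts t))
  vertices-≡ (path _ _ _ _) = refl
  step : ∀ i → i < 3 → Adj (P 4) i (suc i)
  step i i<3 = ∈-upTo⁺ (m<n⇒m<1+n i<3) , ∈-upTo⁺ (s<s i<3) , <⇒≢ ≤-refl , inj₁ refl
  at : ∀ i → i < 3 → ∀ {x y} → x ≡ nth (verts t) i → y ≡ nth (verts t) (suc i) →
       Adj (P 4) (pos x (verts t)) (pos y (verts t))
  at i i<3 refl refl = subst₂ (Adj (P 4)) (sym (pos-nth t! (m<n⇒m<1+n i<3))) (sym (pos-nth t! (s<s i<3))) (step i i<3)
  at-edge : ∀ i → i < 3 → ∀ {x y} → edge x y ≡ edge (nth (verts t) i) (nth (verts t) (suc i)) →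
            Adj (P 4) (pos x (verts t)) (pos y (verts t))
  at-edge i i<3 {x} {y} eq with edge-injective eq
  ... | inj₁ (x≡ , y≡) = at i i<3 x≡ y≡
  ... | inj₂ (x≡ , y≡) = adj-sym (P 4) {pos y (verts t)} (at i i<3 y≡ x≡)
  to-adj : ∀ {x y} → edge x y ∈ edges t → Adj (P 4) (pos x (verts t)) (pos y (verts t))
  to-adj (here eq)                 = at-edge 0 (s≤s z≤n) eq
  to-adj (there (here eq))         = at-edge 1 (s≤s (s≤s z≤n)) eq
  to-adj (there (there (here eq))) = at-edge 2 ≤-refl eq
  consecutive : ∀ i → suc i < 4 → edge (nth (verts t) i) (nth (verts t) (suc i)) ∈ edges t
  consecutive 0 _ = here refl
  consecutive 1 _ = there (here refl)
  consecutive 2 _ = there (there (here refl))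
  consecutive (suc (suc (suc i))) (s≤s (s≤s (s≤s (s≤s ()))))
  from-adj : ∀ {i j} → Adj (P 4) i j → edge (nth (verts t) i) (nth (verts t) j) ∈ edges t
  from-adj (_ , j∈ , _ , inj₁ refl) = consecutive _ (∈-upTo⁻ j∈)
  from-adj {i} {j} (i∈ , _ , _ , inj₂ refl) = flip∈ (nth (verts t) j) (nth (verts t) i) (consecutive _ (∈-upTo⁻ i∈))

InGraph : Graph → Path₄ → Set
InGraph B q = All (_∈ vertices B) (verts q) × (∀ {x y} → edge x y ∈ edges q → Adj B x y)

pathGraph-⊆ : ∀ {B} q q! → InGraph B q → pathGraph q q! ⊆ᴳ B
pathGraph-⊆ q q! (vs , es) = All.lookup vs , es

pathIn : ∀ B {p q r s} → Adj B p q → Adj B q r → Adj B r s → InGraph B (path p q r s)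
pathIn B {p} {q} {r} {s} pq qr rs =
  (adj-∈ B pq ∷ adj-∈ B qr ∷ adj-∈ B rs ∷ adj-∈ B (adj-sym B rs) ∷ []) , λ where
    (here eq)                 → along pq eq
    (there (here eq))         → along qr eq
    (there (there (here eq))) → along rs eq
  where
  along : ∀ {x y z w} → Adj B z w → edge x y ≡ edge z w → Adj B x y
  along zw eq with edge-injective eq
  ... | inj₁ (refl , refl) = zw
  ... | inj₂ (refl , refl) = adj-sym B zw

-- The design obtained from a decomposition of a complete graph

module _ {T : List ℕ} (T! : Unique T) (4≤T : 4 ≤ length T)
         {qs : List Path₄} (qs! : All IsPath qs) (qs↭ : concatMap edges qs ↭ pairs T) where

  private
    block : Fin (length qs) → Graph
    block i = pathGraph (lookup qs i) (All.lookup qs! (∈-lookup i))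

    disjoint : ∀ {i j e} → e ∈ edges (lookup qs i) → e ∈ edges (lookup qs j) → i ≡ j
    disjoint {i} {j} = concatMap-edges-injective {qs} (Unique-resp-↭ (↭-sym qs↭) (pairs-unique T!)) i j

    ends : ∀ i {x y} → edge x y ∈ edges (lookup qs i) → x ∈ T × y ∈ T × x ≢ y
    ends i e∈ = spanned-ends (pairs-spanned T!) (∈-resp-↭ qs↭ (∈-concatMap-edges qs i e∈))

    firstEdge : ∀ q → ∃₂ λ x y → edge x y ∈ edges q
    firstEdge (path p q _ _) = p , q , here refl

    verts⊆ : ∀ q → (∀ {x y} → edge x y ∈ edges q → x ∈ T × y ∈ T × x ≢ y) → ∀ {x} → x ∈ verts q → x ∈ T
    verts⊆ (path p q r s) h (here refl) = proj₁ (h {p} {q} (here refl))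
    verts⊆ (path p q r s) h (there (here refl)) = proj₁ (h {q} {r} (there (here refl)))
    verts⊆ (path p q r s) h (there (there (here refl))) = proj₁ (h {r} {s} (there (there (here refl))))
    verts⊆ (path p q r s) h (there (there (there (here refl)))) = proj₁ (proj₂ (h {r} {s} (there (there (here refl)))))

    somePath : ∀ T (T! : Unique T) → 4 ≤ length T → P 4 ≲ complete T T!
    somePath T@(p ∷ q ∷ r ∷ s ∷ _) T!@((p≢q ∷ p≢r ∷ p≢s ∷ _) ∷ (q≢r ∷ q≢s ∷ _) ∷ (r≢s ∷ _) ∷ _) _ =
      pathGraph t t! , pathGraph-⊆ {complete T T!} t t! (pathIn (complete T T!)
        (here refl , there (here refl) , p≢q)
        (there (here refl) , there (there (here refl)) , q≢r)
        (there (there (here refl)) , there (there (there (here refl))) , r≢s)) , pathGraph≅P t t!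
      where
      t = path p q r s
      t! : IsPath t
      t! = (p≢q ∷ p≢r ∷ p≢s ∷ []) ∷ (q≢r ∷ q≢s ∷ []) ∷ (r≢s ∷ []) ∷ [] ∷ []
    somePath (_ ∷ []) _ (s≤s ())
    somePath (_ ∷ _ ∷ []) _ (s≤s (s≤s ()))
    somePath (_ ∷ _ ∷ _ ∷ []) _ (s≤s (s≤s (s≤s ())))

  pathDesign : DesignOfOrder (length T) (P 4)
  pathDesign = record
    { host     = complete T T!
    ; complete = complete≅K T T!
    ; design   = record
      { Γ≲G       = somePath T T! 4≤T
      ; size      = length qs
      ; block     = block
      -- Every path has an edge, and a block containing it has the same index.
      ; distinct  = λ {i} {j} (_ , i⊆j) _ →
          let x , y , e∈ = firstEdge (lookup qs i) in disjoint e∈ (i⊆j {x} {y} e∈)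
      ; block⊆    = λ i → verts⊆ (lookup qs i) (ends i) , λ {x} {y} → ends i {x} {y}
      ; block≅    = λ i → pathGraph≅P (lookup qs i) _
      ; partition = λ (x∈ , y∈ , x≢y) →
          let found = ∈-concatMap⁻ edges {xs = qs} (∈-resp-↭ (↭-sym qs↭) (∈-pairs⁺ x∈ y∈ x≢y))
          in index found , lookup-index found , disjoint (lookup-index found)
      }
    }

  pathDesign-linked : ∀ {v Γ} (𝓑 : DesignOfOrder v Γ) → P 4 ≲ Γ →
                      (∀ i → ∃ λ q → q ∈ qs × InGraph (DesignOfOrder.block 𝓑 i) q) → DownLinked 𝓑 pathDesign
  pathDesign-linked 𝓑 P≲Γ links = record
    { Γ′≲Γ = P≲Γ
    ; link = λ i → index (proj₁ (proj₂ (links i)))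
    ; sub  = λ i → let q , q∈ , q⊆ = links i in
        pathGraph-⊆ {DesignOfOrder.block 𝓑 i} (lookup qs (index q∈)) (All.lookup qs! (∈-lookup (index q∈))) 
          (subst (InGraph (DesignOfOrder.block 𝓑 i)) (lookup-index q∈) q⊆)
    }

-- Four consecutive vertices of a cycle

module _ (k : ℕ) where

  next : ℕ → ℕ
  next i with suc i <? k
  ... | yes _ = suc i
  ... | no  _ = 0

  prev : ℕ → ℕ
  prev zero    = pred k
  prev (suc i) = i

  next-cases : ∀ {i} → i < k → next i ≡ suc i ⊎ (suc i ≡ k × next i ≡ 0)
  next-cases {i} i<k with suc i <? k
  ... | yes _ = inj₁ refl
  ... | no  ≮ = inj₂ (≤-antisym i<k (≮⇒≥ ≮) , refl)

  next-< : ∀ {i} → i < k → next i < k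
  next-< {i} i<k with suc i <? k
  ... | yes lt = lt
  ... | no  _  = ≤-<-trans z≤n i<k

  prev-next : ∀ {i} → i < k → prev (next i) ≡ i
  prev-next {i} i<k with next i | next-cases i<k
  ... | _ | inj₁ refl          = refl
  ... | _ | inj₂ (refl , refl) = refl

  private
    -- Says that `m` is `i` + `j` modulo `k` with at most one turn round the cycle.
    At : ℕ → ℕ → ℕ → Set
    At i j m = m ≡ i + j ⊎ m + k ≡ i + j

    at-suc : ∀ {i j m} → i < k → suc j < k → m < k → At i j m → At i (suc j) (next m)
    at-suc {i} {j} {m} i<k j<k m<k at with next m | next-cases m<k | at
    ... | _ | inj₁ refl         | inj₁ refl = inj₁ (sym (+-suc i j))
    ... | _ | inj₁ refl         | inj₂ eq   = inj₂ (trans (cong suc eq) (sym (+-suc i j)))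
    ... | _ | inj₂ (eq , refl)  | inj₁ refl = inj₂ (trans (sym eq) (sym (+-suc i j)))
    -- A second turn would force `i` + `suc j` = `k` + `k`, although both summands are below `k`.
    ... | _ | inj₂ (eq , refl)  | inj₂ eq′  = contradiction
      (trans (+-suc i j) (trans (cong suc (sym eq′)) (cong (_+ k) eq))) (<⇒≢ (+-mono-< i<k j<k))

    at-≢ : ∀ {i j m} → 0 < j → j < k → At i j m → i ≢ m
    at-≢ {i} {suc j} _ _   (inj₁ eq) refl = m≢1+m+n i (trans eq (+-suc i j))
    at-≢ {i} {j}     _ j<k (inj₂ eq) refl = <⇒≢ j<k (sym (+-cancelˡ-≡ i k j eq))

  next-≢ : ∀ {i} → i < k → 4 ≤ k → i ≢ next i × i ≢ next (next i) × i ≢ next (next (next i))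
  next-≢ {i} i<k 4≤k = at-≢ z<s 1<k at₁ , at-≢ z<s 2<k at₂ , at-≢ z<s 4≤k at₃
    where
    2<k : 2 < k
    2<k = ≤-trans (n≤1+n 3) 4≤k
    1<k : 1 < k
    1<k = ≤-trans (n≤1+n 2) 2<k
    at₁ : At i 1 (next i)
    at₁ = at-suc i<k 1<k i<k (inj₁ (sym (+-identityʳ i)))
    at₂ : At i 2 (next (next i))
    at₂ = at-suc i<k 2<k (next-< i<k) at₁
    at₃ : At i 3 (next (next (next i)))
    at₃ = at-suc i<k 4≤k (next-< (next-< i<k)) at₂

  C-next : ∀ {i} → i < k → 4 ≤ k → Adj (C k) i (next i)
  C-next i<k 4≤k = ∈-upTo⁺ i<k , ∈-upTo⁺ (next-< i<k) , proj₁ (next-≢ i<k 4≤k) ,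
    inj₁ (map₁ sym (next-cases i<k))

  module _ {B : Graph} (B≅C : B ≅ C k) (4≤k : 4 ≤ k) (D : List ℕ) (few : 4 * length D < k) where

    open _≅_ B≅C

    private
      window : ℕ → Path₄
      window i = path (from i) (from (next i)) (from (next (next i))) (from (next (next (next i))))

      from-injective : ∀ {i j} → i < k → j < k → from i ≡ from j → i ≡ j
      from-injective i<k j<k eq = trans (sym (to∘from (∈-upTo⁺ i<k))) (trans (cong to eq) (to∘from (∈-upTo⁺ j<k)))

      window-simple : ∀ {i} → i < k → IsPath (window i)
      window-simple i<k =
        let i₁ = next-< i<k
            i₂ = next-< i₁
            i₃ = next-< i₂
            i≢₁ , i≢₂ , i≢₃ = next-≢ i<k 4≤k
            j≢₁ , j≢₂ , _   = next-≢ i₁ 4≤k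
            l≢₁ , _         = next-≢ i₂ 4≤k
        in ((i≢₁ ∘ from-injective i<k i₁) ∷ (i≢₂ ∘ from-injective i<k i₂) ∷ (i≢₃ ∘ from-injective i<k i₃) ∷ [])
         ∷ ((j≢₁ ∘ from-injective i₁ i₂) ∷ (j≢₂ ∘ from-injective i₁ i₃) ∷ [])
         ∷ ((l≢₁ ∘ from-injective i₂ i₃) ∷ []) ∷ [] ∷ []

      window-in : ∀ {i} → i < k → InGraph B (window i)
      window-in i<k = pathIn B (from-adj (C-next i<k 4≤k)) (from-adj (C-next (next-< i<k) 4≤k))
                               (from-adj (C-next (next-< (next-< i<k)) 4≤k))

      -- The starting points of the four windows that contain d.
      starts : ℕ → List ℕ
      starts d = to d ∷ prev (to d) ∷ prev (prev (to d)) ∷ prev (prev (prev (to d))) ∷ []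

      length-starts : ∀ D → length (concatMap starts D) ≡ 4 * length D
      length-starts []      = refl
      length-starts (_ ∷ D) = trans (cong (4 +_) (length-starts D)) (sym (*-suc 4 (length D)))

      to-from : ∀ {i} → i < k → to (from i) ≡ i
      to-from = to∘from ∘ ∈-upTo⁺

      -- If the vertex at offset j of the window is some d in `D`, then `i` is the j-fold
      -- predecessor of `to d`.
      caught : ∀ {i} → i < k → ¬ All (_∉ D) (verts (window i)) → i ∈ concatMap starts D
      caught {i} i<k hit with mem? _≟_ (from i) D | mem? _≟_ (from (next i)) D
                            | mem? _≟_ (from (next (next i))) D | mem? _≟_ (from (next (next (next i)))) D
      ... | yes d | _ | _ | _ = ∈-concatMap⁺ starts (lose d (here (sym (to-from i<k))))
      ... | _ | yes d | _ | _ = ∈-concatMap⁺ starts (lose d (there (here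
        (sym (trans (cong prev (to-from (next-< i<k))) (prev-next i<k))))))
      ... | _ | _ | yes d | _ = ∈-concatMap⁺ starts (lose d (there (there (here
        (sym (trans (cong (prev ∘ prev) (to-from (next-< (next-< i<k))))
             (trans (cong prev (prev-next (next-< i<k))) (prev-next i<k))))))))
      ... | _ | _ | _ | yes d = ∈-concatMap⁺ starts (lose d (there (there (there (here
        (sym (trans (cong (prev ∘ prev ∘ prev) (to-from (next-< (next-< (next-< i<k)))))
             (trans (cong (prev ∘ prev) (prev-next (next-< (next-< i<k))))
             (trans (cong prev (prev-next (next-< i<k))) (prev-next i<k))))))))))
      ... | no ¬p | no ¬q | no ¬r | no ¬s = contradiction (¬p ∷ ¬q ∷ ¬r ∷ ¬s ∷ []) hit

      avoids? : ∀ i → Dec (All (_∉ D) (verts (window i)))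
      avoids? i = All.all? (λ x → ¬? (mem? _≟_ x D)) (verts (window i))

    -- Pigeonhole: each entry of `D` spoils at most four of the `k` starting points, and 4 |D| < k.
    avoiding-path : ∃ λ q → IsPath q × InGraph B q × All (_∉ D) (verts q)
    avoiding-path with any? avoids? (upTo k)
    ... | yes found =
      let i , i∈ , avoids = find found
          i<k = ∈-upTo⁻ i∈
      in window i , window-simple i<k , window-in i<k , avoids
    ... | no none = contradiction few (≤⇒≯ (subst₂ _≤_ (length-upTo k) (length-starts D)
      (⊆⇒length≤ (upTo⁺ k) λ i∈ → caught (∈-upTo⁻ i∈) (none ∘ lose i∈))))

-- The vertex set of the target

≤-sum : ∀ {x xs} → x ∈ xs → x ≤ sum xs
≤-sum {xs = x ∷ xs} (here refl) = m≤m+n x (sum xs)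
≤-sum {xs = y ∷ xs} (there x∈)  = ≤-trans (≤-sum x∈) (m≤n+m (sum xs) y)

∈-take-++ : ∀ {x} {xs : List ℕ} n ys → x ∈ xs → x ∉ drop n xs → x ∈ take n (xs ++ ys)
∈-take-++ zero    ys x∈          x∉ = contradiction x∈ x∉
∈-take-++ (suc n) ys (here refl) x∉ = here refl
∈-take-++ (suc n) ys (there x∈)  x∉ = there (∈-take-++ n ys x∈ x∉)

-- The list `drop n V` accounts for the source vertices outside the target, so a path of the source
-- that misses it together with `a` and `b` lies on `W`.
record Target (V : List ℕ) (n : ℕ) : Set where
  field
    {a b}    : ℕ
    {W}      : List ℕ
    distinct : Unique (a ∷ b ∷ W)
    order    : length (a ∷ b ∷ W) ≡ n
    inside   : ∀ {x} → x ∈ V → x ∉ a ∷ b ∷ drop n V → x ∈ W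

-- Padding `V` with `n` fresh vertices and keeping the first `n` treats small and large `n` alike.
target : ∀ {V n} → Unique V → 2 ≤ length V → 2 ≤ n → Target V n
target {V@(a ∷ b ∷ V′)} {n@(suc (suc n′))} V! _ _ = record
  { distinct = take⁺ n (Unique-++⁺ V! (Unique-map⁺ (+-cancelˡ-≡ (suc (sum V)) _ _) (upTo⁺ n)) fresh)
  ; order    = trans (length-take n (V ++ new)) (m≤n⇒m⊓n≡m (subst (n ≤_) (sym length-V++new) (m≤n+m n (length V))))
  ; inside   = λ where
      (here refl)         x∉ → contradiction (here refl) x∉
      (there (here refl)) x∉ → contradiction (there (here refl)) x∉
      (there (there x∈))  x∉ → ∈-take-++ n′ new x∈ (x∉ ∘ there ∘ there)
  }
  where
  new : List ℕ
  -- Every entry of `V` is at most `sum V`, so these numbers are fresh.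
  new = map (suc (sum V) +_) (upTo n)
  length-V++new : length (V ++ new) ≡ length V + n
  length-V++new = trans (length-++ V) (cong (length V +_) (trans (length-map (suc (sum V) +_) (upTo n)) (length-upTo n)))
  fresh : Disjoint V new
  fresh (x∈ , x∈new) with i , _ , refl ← ∈-map⁻ (suc (sum V) +_) x∈new =
    <⇒≱ (s≤s (m≤m+n (sum V) i)) (≤-sum x∈)

target {_ ∷ []}     _ (s≤s ()) _
target {_ ∷ _ ∷ _} {suc zero} _ _ (s≤s ())

-- The complete graph is itself a cone; taking away paths on `W` changes only its graph part.
pairs-cone : ∀ a b W → pairs (a ∷ b ∷ W) ↭ Cone.cone a b nothing W (pairs W)
pairs-cone a b W = ↭-prep _ (↭-trans (↭-sym (++-assoc (map (edge a) W) (map (edge b) W) (pairs W)))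
  (++⁺ʳ (pairs W) (interleave W)))
  where
  interleave : ∀ W → map (edge a) W ++ map (edge b) W ↭ Cone.join a b W
  interleave []      = ↭-refl
  interleave (x ∷ W) = ↭-prep _ (↭-trans (shift (edge b x) (map (edge a) W) (map (edge b) W)) (↭-prep _ (interleave W)))

edges-form : ∀ q {e} → e ∈ edges q → ∃₂ λ x y → e ≡ edge x y
edges-form (path p q r s) (here refl)                 = p , q , refl
edges-form (path p q r s) (there (here refl))         = q , r , refl
edges-form (path p q r s) (there (there (here refl))) = r , s , refl

common-edge : ∀ B B′ q q′ {e} → InGraph B q → InGraph B′ q′ → e ∈ edges q → e ∈ edges q′ →
              ∃₂ λ x y → Adj B x y × Adj B′ x y
common-edge _ _ q _ q⊆B q′⊆B′ e∈ e∈′ with x , y , refl ← edges-form q e∈ = x , y , proj₂ q⊆B e∈ , proj₂ q′⊆B′ e∈′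

edges⊆pairs : ∀ {W qs} → All IsPath qs → All (All (_∈ W) ∘ verts) qs → ∀ {e} → e ∈ concatMap edges qs → e ∈ pairs W
edges⊆pairs {qs = q ∷ qs} (q! ∷ qs!) (q⊆W ∷ qs⊆W) e∈ with ∈-++⁻ (edges q) e∈
... | inj₂ e∈ʳ = edges⊆pairs qs! qs⊆W e∈ʳ
... | inj₁ e∈ˡ with x , y , refl ← edges-form q e∈ˡ =
  ∈-pairs⁺ (All.lookup q⊆W (edges⇒verts q e∈ˡ)) (All.lookup q⊆W (edges⇒verts q (flip∈ x y e∈ˡ)))
    λ where refl → edges-≢ q q! e∈ˡ

P-≲-C : ∀ {k} → 4 ≤ k → P 4 ≲ C k
P-≲-C {k} 4≤k = P 4 , (widen , λ where
    (i∈ , j∈ , i≢j , inj₁ eq) → widen i∈ , widen j∈ , i≢j , inj₁ (inj₁ eq)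
    (i∈ , j∈ , i≢j , inj₂ eq) → widen i∈ , widen j∈ , i≢j , inj₂ (inj₁ eq)) , ≅-refl
  where
  widen : ∀ {i} → i ∈ upTo 4 → i ∈ upTo k
  widen i∈ = ∈-upTo⁺ (<-≤-trans (∈-upTo⁻ i∈) 4≤k)

-- Choosing the links and completing them to a design

module _ {k v n : ℕ} (𝓑 : DesignOfOrder v (C k)) (4≤k : 4 ≤ k) (4≤n : 4 ≤ n)
         (few : 4 * (2 + (length (vertices (DesignOfOrder.host 𝓑)) ∸ n)) < k)
         (4≤V : 4 ≤ length (vertices (DesignOfOrder.host 𝓑)))
         (n%3 : n % 3 ≡ 0 ⊎ n % 3 ≡ 1) where

  open DesignOfOrder 𝓑 hiding (complete; distinct)

  private
    V : List ℕ
    V = vertices host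

    open Target (target {V} {n} (unique host) (≤-trans (s≤s (s≤s z≤n)) 4≤V) (≤-trans (s≤s (s≤s z≤n)) 4≤n))
    open Cone a b

    -- Links avoid `a` and `b` to leave the cone edges untouched, and avoid the rest to stay inside
    -- the target.
    D : List ℕ
    D = a ∷ b ∷ drop n V

    chosen : ∀ i → ∃ λ q → IsPath q × InGraph (block i) q × All (_∉ D) (verts q)
    chosen i = avoiding-path k (block≅ i) 4≤k D (subst (λ l → 4 * (2 + l) < k) (sym (length-drop n V)) few)

    link : Fin size → Path₄
    link = proj₁ ∘ chosen

    link-path : ∀ i → IsPath (link i)
    link-path i = proj₁ (proj₂ (chosen i))

    link-in : ∀ i → InGraph (block i) (link i)
    link-in i = proj₁ (proj₂ (proj₂ (chosen i)))

    link⊆W : ∀ i {x} → x ∈ verts (link i) → x ∈ W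
    link⊆W i x∈ = inside (proj₁ (block⊆ i) (All.lookup (proj₁ (link-in i)) x∈))
                         (All.lookup (proj₂ (proj₂ (proj₂ (chosen i)))) x∈)

    links : List Path₄
    links = tabulate link

    links-path : All IsPath links
    links-path = All.tabulate⁺ link-path

    -- An edge common to two links would lie in two blocks of the given design.
    links-disjoint : ∀ {i j} → i ≢ j → Disjoint (edges (link i)) (edges (link j))
    links-disjoint {i} {j} i≢j (e∈i , e∈j) =
      let _ , _ , in-i , in-j = common-edge (block i) (block j) (link i) (link j) (link-in i) (link-in j) e∈i e∈j
          _ , _ , only        = partition (proj₂ (block⊆ i) in-i)
      in i≢j (trans (sym (only in-i)) (only in-j))

    links-unique : Unique (concatMap edges links)
    links-unique = concat⁺ (All.map⁺ (All.tabulate⁺ λ i → edges-unique (link i) (link-path i)))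
                           (AllPairs.map⁺ (AllPairs.tabulate⁺ links-disjoint))

    W! : Unique W
    W! = proj₁ (proj₂ (Unique-++⁻ (a ∷ b ∷ []) distinct))

    rest : ∃ λ E → pairs W ↭ concatMap edges links ++ E
    rest = ⊆⇒↭++ links-unique (edges⊆pairs links-path (All.tabulate⁺ λ i → All.tabulate (link⊆W i)))

    E : List Edge
    E = proj₁ rest

    E-unique : Unique E
    E-unique = proj₁ (proj₂ (Unique-++⁻ (concatMap edges links) (Unique-resp-↭ (proj₂ rest) (pairs-unique W!))))

    E-spanned : Spanned W E
    E-spanned e∈ = pairs-spanned W! (∈-resp-↭ (↭-sym (proj₂ rest)) (∈-++⁺ʳ (concatMap edges links) e∈))

    pairs-split : pairs (a ∷ b ∷ W) ↭ concatMap edges links ++ cone nothing W E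
    pairs-split = ↭-trans (pairs-cone a b W) (↭-trans
      (++⁺ˡ (edge a b ∷ join W) (proj₂ rest))
      (shifts (edge a b ∷ join W) (concatMap edges links)))

    -- The complete graph of order `n` has a multiple of 3 edges, and so have the links.
    3∣cone : 3 ∣ length (cone nothing W E)
    3∣cone = ∣m+n∣m⇒∣n
      (subst (3 ∣_) (trans (↭-length pairs-split) (length-++ (concatMap edges links)))
        (3∣length-pairs (a ∷ b ∷ W) (subst (λ m → m % 3 ≡ 0 ⊎ m % 3 ≡ 1) (sym order) n%3)))
      (length-edges links)

    4≤T : 4 ≤ length (a ∷ b ∷ W)
    4≤T = subst (4 ≤_) (sym order) 4≤n

    completion : Decomposable (cone nothing W E)
    -- Of the at least four target vertices, two besides `a` and `b` lie in `W`, which is `Large`.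
    completion = cone-decomposable (length E) nothing W E ≤-refl distinct (s≤s⁻¹ (s≤s⁻¹ 4≤T)) E-spanned E-unique 3∣cone

  linked-path-design : Σ (DesignOfOrder n (P 4)) (DownLinked 𝓑)
  linked-path-design = let rs , rs! , rs↭ = completion in
    subst (λ m → Σ (DesignOfOrder m (P 4)) (DownLinked 𝓑)) order
      ( pathDesign distinct 4≤T (All.++⁺ links-path rs!) (all↭ rs rs↭)
      , pathDesign-linked distinct 4≤T (All.++⁺ links-path rs!) (all↭ rs rs↭) 𝓑 (P-≲-C 4≤k)
          (λ i → link i , ∈-++⁺ˡ (∈-tabulate⁺ i) , link-in i) )
    where
    all↭ : ∀ rs → concatMap edges rs ↭ cone nothing W E → concatMap edges (links ++ rs) ↭ pairs (a ∷ b ∷ W)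
    all↭ rs rs↭ = ↭-trans (↭-reflexive (concatMap-++ links rs))
      (↭-trans (++⁺ˡ (concatMap edges links) rs↭) (↭-sym pairs-split))

-- The numerical bounds

design-order : ∀ {k v} (𝓑 : DesignOfOrder v (C k)) →
               k ≤ length (vertices (DesignOfOrder.host 𝓑)) × length (vertices (DesignOfOrder.host 𝓑)) ≤ v
-- The copy of `C k` that `Γ≲G` places in the host gives the lower bound.
design-order {k} {v} 𝓑 with H , (H⊆ , _) , H≅C ← DesignOfOrder.Γ≲G 𝓑 =
  subst (_≤ _) (length-upTo k) (≤-trans (≅⇒length≤ (≅-sym H≅C)) (⊆⇒length≤ (unique H) H⊆)) ,
  subst (_ ≤_) (length-upTo v) (≅⇒length≤ (DesignOfOrder.complete 𝓑))

theorem4p1 : (k v : ℕ) → k ≥ 9 → Admissible (C k) v →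
    ((λ n → n ≥ v ∸ (k ∸ 9) / 4 × (n % 3 ≡ 0 ⊎ n % 3 ≡ 1)) ⊆ 𝓛₂ (C k) v)
    × (𝓛₂ (C k) v ⊆ 𝓛₁ (C k) v)
-- Admissibility supplies a design to which a statement about all designs can be applied.
theorem4p1 k v k≥9 admissible = down-link , λ f → admissible , f admissible
  where
  t : ℕ
  t = (k ∸ 9) / 4

  4≤k : 4 ≤ k
  4≤k = ≤-trans (m≤m+n 4 5) k≥9

  down-link : (λ n → n ≥ v ∸ t × (n % 3 ≡ 0 ⊎ n % 3 ≡ 1)) ⊆ 𝓛₂ (C k) v
  down-link {n} (n≥ , n%3) 𝓑 = linked-path-design 𝓑 4≤k 4≤n few (≤-trans 4≤k k≤V) n%3
    where
    V = vertices (DesignOfOrder.host 𝓑)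
    k≤V : k ≤ length V
    k≤V = proj₁ (design-order 𝓑)
    V≤v : length V ≤ v
    V≤v = proj₂ (design-order 𝓑)
    4≤n : 4 ≤ n
    -- Since `t` is at most `k` - 9 and `k` at most `v`, subtracting `t` from `v` leaves at least 4.
    4≤n = ≤-trans (m+n≤o⇒m≤o∸n 4 (begin
      4 + t        ≤⟨ +-mono-≤ (m≤m+n 4 5) (m/n≤m (k ∸ 9) 4) ⟩
      9 + (k ∸ 9)  ≡⟨ m+[n∸m]≡n k≥9 ⟩
      k            ≤⟨ ≤-trans k≤V V≤v ⟩
      v            ∎)) n≥
      where open ≤-Reasoning
    few : 4 * (2 + (length V ∸ n)) < k
    -- Here the 9 is spent: `a` and `b` cost 8, and 4t is at most `k` - 9, so the total is at most
    -- `k` - 1.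
    few = begin-strict
      4 * (2 + (length V ∸ n))  ≤⟨ *-monoʳ-≤ 4 (+-monoʳ-≤ 2 (m≤n+o⇒m∸n≤o (length V) n V≤n+t)) ⟩
      4 * (2 + t)               ≡⟨ *-distribˡ-+ 4 2 t ⟩
      8 + 4 * t                 ≡⟨ cong (8 +_) (*-comm 4 t) ⟩
      8 + t * 4                 ≤⟨ +-monoʳ-≤ 8 (m/n*n≤m (k ∸ 9) 4) ⟩
      8 + (k ∸ 9)               <⟨ ≤-refl ⟩
      9 + (k ∸ 9)               ≡⟨ m+[n∸m]≡n k≥9 ⟩
      k                         ∎
      where
      open ≤-Reasoning
      V≤n+t : length V ≤ n + t
      V≤n+t = ≤-trans V≤v (≤-trans (m≤n+m∸n v t) (≤-trans (+-monoʳ-≤ t n≥) (≤-reflexive (+-comm t n))))
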